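{- Let $K$ be an algebraically closed field of characteristic zero, let $q\in K\setminus\{0\}$ be a root of unity, and let $m$ be the minimal positive integer with $q^m=1$. Let $\partial_x\in\{D_x,\Delta_x,\Delta_{q,x}\}$ and let $f,g\in K(x,y)$ satisfy $\partial_x(f)=\Delta_{q,y}(g)$. Then there exist rational functions $h\in K(x,y)$ and $a,b\in K(x)(y^m)$ such that $\partial_x(a)=0$ and \[ f=\Delta_{q,y}(h)+a\quad\text{and}\quad g=\partial_x(h)+b. \] Moreover, $a\in K(y^m)$ if $\partial_x\in\{D_x,\Delta_x\}$, and $a\in K(x^m,y^m)$ if $\partial_x=\Delta_{q,x}$.
   Context: $K(x,y)$ is the field of rational functions in $x,y$ over $K$. $D_x=\partial/\partial x$ is the usual derivation. $\sigma_x(f(x,y))=f(x+1,y)$, $\tau_{q,x}(f(x,y))=f(qx,y)$, $\tau_{q,y}(f(x,y))=f(x,qy)$. The difference operators are $\Delta_x(f)=\sigma_x(f)-f$, $\Delta_{q,x}(f)=\tau_{q,x}(f)-f$ and $\Delta_{q,y}(f)=\tau_{q,y}(f)-f$. $K(x)(y^m)$ denotes the subfield of $K(x,y)$ of rational functions in $x$ and $y^m$ (similarly $K(y^m)$, $K(x^m,y^m)$). -}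

module Defs where

open import Level using (_⊔_)
open import Data.Nat as ℕ using (ℕ; zero; suc; _∸_; _≤_; _<_)
open import Data.Nat.Divisibility using (_∣_)
open import Data.Nat.Combinatorics using (_C_)
open import Data.List using (List; []; _∷_; _++_; map; concatMap; upTo)
open import Data.Product using (Σ; ∃; _×_; _,_)
open import Relation.Nullary using (¬_; yes; no)
open import Relation.Binary.PropositionalEquality using (_≡_)
open import Algebra.Bundles using (CommutativeRing)

record Field (c ℓ : Level.Level) : Set (Level.suc (c ⊔ ℓ)) where
  field
    commutativeRing : CommutativeRing c ℓ
  open CommutativeRing commutativeRing public
  field
    0≉1     : ¬ (0# ≈ 1#)
    inverse : ∀ x → ¬ (x ≈ 0#) → ∃ λ y → (x * y) ≈ 1#

module Over {c ℓ} (F : Field c ℓ) where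
  open Field F public

  ι : ℕ → Carrier
  ι zero    = 0#
  ι (suc n) = 1# + ι n

  pow : Carrier → ℕ → Carrier
  pow a zero    = 1#
  pow a (suc n) = a * pow a n

  sumK : ℕ → (ℕ → Carrier) → Carrier
  sumK zero    f = 0#
  sumK (suc n) f = f n + sumK n f

  CharZero : Set ℓ
  CharZero = ∀ n → ¬ (ι (suc n) ≈ 0#)

  AlgClosed : Set (c ⊔ ℓ)
  AlgClosed = ∀ n (a : ℕ → Carrier) →
    ∃ λ x → (pow x (suc n) + sumK (suc n) (λ i → a i * pow x i)) ≈ 0#

  MinimalOrder : Carrier → ℕ → Set ℓ
  MinimalOrder q m = (1 ≤ m) × (pow q m ≈ 1#) × (∀ k → 1 ≤ k → k < m → ¬ (pow q k ≈ 1#))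

  -- K[x,y]: a polynomial is a finite formal sum of monomials c·x^i·y^j,
  -- compared coefficientwise.
  Mono : Set c
  Mono = Carrier × ℕ × ℕ

  Poly : Set c
  Poly = List Mono

  coeff : Poly → ℕ → ℕ → Carrier
  coeff []                  i j = 0#
  coeff ((a , i' , j') ∷ p) i j with i ℕ.≟ i' | j ℕ.≟ j'
  ... | yes _ | yes _ = a + coeff p i j
  ... | _     | _     = coeff p i j

  _≈P_ : Poly → Poly → Set ℓ
  p ≈P r = ∀ i j → coeff p i j ≈ coeff r i j

  0P 1P : Poly
  0P = []
  1P = (1# , 0 , 0) ∷ []

  _+P_ : Poly → Poly → Poly
  p +P r = p ++ r

  -P_ : Poly → Poly
  -P p = map (λ { (a , i , j) → (- a , i , j) }) p

  _*P_ : Poly → Poly → Poly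
  p *P r = concatMap (λ { (a , i , j) →
             map (λ { (b , k , l) → (a * b , i ℕ.+ k , j ℕ.+ l) }) r }) p

  NonZeroP : Poly → Set ℓ
  NonZeroP p = ¬ (p ≈P 0P)

  -- f(x,y) ↦ f(x+1,y):  a x^i y^j ↦ Σ_{k ≤ i} a·(i choose k) x^k y^j
  σxP : Poly → Poly
  σxP = concatMap (λ { (a , i , j) →
          map (λ k → (a * ι (i C k) , k , j)) (upTo (suc i)) })

  τxP : Carrier → Poly → Poly
  τxP q = map (λ { (a , i , j) → (a * pow q i , i , j) })

  τyP : Carrier → Poly → Poly
  τyP q = map (λ { (a , i , j) → (a * pow q j , i , j) })

  DxP : Poly → Poly
  DxP = map (λ { (a , i , j) → (ι i * a , i ∸ 1 , j) })

  -- K(x,y): fractions num/den with den ≠ 0; equality by cross-multiplication.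
  Rat : Set c
  Rat = Poly × Poly

  num den : Rat → Poly
  num (n , d) = n
  den (n , d) = d

  Valid : Rat → Set ℓ
  Valid f = NonZeroP (den f)

  _≈R_ : Rat → Rat → Set ℓ
  (n₁ , d₁) ≈R (n₂ , d₂) = (n₁ *P d₂) ≈P (n₂ *P d₁)

  0R : Rat
  0R = (0P , 1P)

  _+R_ : Rat → Rat → Rat
  (n₁ , d₁) +R (n₂ , d₂) = ((n₁ *P d₂) +P (n₂ *P d₁) , d₁ *P d₂)

  _-R_ : Rat → Rat → Rat
  (n₁ , d₁) -R (n₂ , d₂) = ((n₁ *P d₂) +P (-P (n₂ *P d₁)) , d₁ *P d₂)

  σx : Rat → Rat
  σx (n , d) = (σxP n , σxP d)

  τx τy : Carrier → Rat → Rat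
  τx q (n , d) = (τxP q n , τxP q d)
  τy q (n , d) = (τyP q n , τyP q d)

  Dx : Rat → Rat
  Dx (n , d) = ((DxP n *P d) +P (-P (n *P DxP d)) , d *P d)

  Δx : Rat → Rat
  Δx f = σx f -R f

  Δqx Δqy : Carrier → Rat → Rat
  Δqx q f = τx q f -R f
  Δqy q f = τy q f -R f

  data XOp : Set where
    D Δ Δq : XOp

  ∂x : XOp → Carrier → Rat → Rat
  ∂x D  q f = Dx f
  ∂x Δ  q f = Δx f
  ∂x Δq q f = Δqx q f

  -- Subfields.  A polynomial lies in a subring when its only nonzero
  -- coefficients are at admissible exponents (i,j); a rational function
  -- lies in the generated subfield when it equals a quotient of two such
  -- polynomials with nonzero denominator.
  Supported : (ℕ → ℕ → Set) → Poly → Set ℓ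
  Supported Adm p = ∀ i j → ¬ Adm i j → coeff p i j ≈ 0#

  InSubfield : (ℕ → ℕ → Set) → Rat → Set (c ⊔ ℓ)
  InSubfield Adm f = ∃ λ (r : Rat) →
    Valid r × Supported Adm (num r) × Supported Adm (den r) × (f ≈R r)

  Adm-x-ym : ℕ → ℕ → ℕ → Set
  Adm-x-ym m i j = m ∣ j
  Adm-ym : ℕ → ℕ → ℕ → Set
  Adm-ym m i j = (i ≡ 0) × (m ∣ j)
  Adm-xm-ym : ℕ → ℕ → ℕ → Set
  Adm-xm-ym m i j = (m ∣ i) × (m ∣ j)

  ExtraCondition : XOp → ℕ → Rat → Set (c ⊔ ℓ)
  ExtraCondition D  m a = InSubfield (Adm-ym m) a
  ExtraCondition Δ  m a = InSubfield (Adm-ym m) a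
  ExtraCondition Δq m a = InSubfield (Adm-xm-ym m) a

{-# OPTIONS --safe #-}
module Submission where

-- Write f and g over a common denominator W that is invariant under τ = τ_{q,y}
-- (a product of conjugates) and split the numerator of f as A₀ + (τ H − H) with
-- A₀ supported on the powers of y^m; this is possible since q^j − 1 is invertible
-- for m ∤ j.  Then h = H/W and a = A₀/W.  The hypothesis turns into an identity
-- τ Y − Y = Z with Z the τ-invariant numerator of ∂ₓ a, which forces Z = 0 and
-- τ Y = Y, where Y is a numerator of b = g − ∂ₓ h.
--
-- The three operators are treated together as twisted derivations,
-- ∂(pr) = ∂p r + θp ∂r.  For D_x and Δ_x the x-independence of a = A/V is seen by
-- comparing with its value at x = y^n, n large: the substitution is injective on
-- the polynomials involved, so the denominator survives, and Taylor expansion at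
-- y^n gives A(x,y) V(y^n,y) = A(y^n,y) V(x,y).  For Δ_{q,x} one makes the
-- denominator invariant under τ_{q,x} by a norm again.
--
-- The equality of K is neither decidable nor stable, so a nonzero polynomial
-- cannot be cancelled.  Identities that hold after multiplication by a nonzero
-- polynomial T are used by putting T into numerator and denominator instead.

open import Defs
open import Level using (_⊔_)
open import Algebra.Bundles using (CommutativeRing)
open import Algebra.Solver.Ring.AlmostCommutativeRing using (fromCommutativeRing; _-Raw-AlmostCommutative⟶_)
import Algebra.Solver.Ring as RingSolver
import Algebra.Properties.Ring as RingProperties
import Algebra.Properties.AbelianGroup as AbelianGroupProperties
import Algebra.Properties.Semiring.Mult as Multiples
open import Data.Nat as ℕ using (ℕ; zero; suc; _∸_; _≤_; _<_; z≤n; s≤s)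
import Data.Nat.Properties as ℕ
open import Data.Nat.Combinatorics using (_C_; nCk+nC[k+1]≡[n+1]C[k+1]; nCk≡nC[n∸k]; nCn≡1; k>n⇒nCk≡0)
open import Data.Nat.Divisibility using (_∣_; _∣?_; divides; m%n≡0⇒n∣m; m∣m*n; ∣n⇒∣m*n)
open import Data.Nat.DivMod using (_/_; _%_; m≡m%n+[m/n]*n; m%n<n; [m+kn]%n≡m%n; m<n⇒m%n≡m)
open import Data.Nat.Solver using (module +-*-Solver)
open import Data.Integer as ℤ using (ℤ; +_; -[1+_]; _⊖_)
import Data.Integer.Properties as ℤ
open import Data.List using ([]; _∷_; _++_; map; concatMap; applyUpTo)
import Data.List.Properties as List
open import Data.Maybe using (Maybe; just; nothing)
open import Data.Product using (∃; _×_; _,_; proj₁; proj₂)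
open import Data.Sum using (_⊎_; inj₁; inj₂)
open import Data.Empty using (⊥-elim)
open import Function using (_∘_; id)
open import Relation.Nullary using (¬_; Dec; yes; no)
open import Relation.Binary.Definitions using (tri<; tri≈; tri>)
open import Relation.Binary.PropositionalEquality as ≡ using (_≡_)
import Relation.Binary.Reasoning.Setoid as SetoidReasoning

-- Clearing denominators in the hypothesis leaves a surplus factor W²; therefore a is represented by
-- W² A₀ / W³, and b carries the same surplus. If A/V is constant, then ∂ⁿA · V = ∂ⁿV · A in the
-- field of fractions, but among polynomials only after multiplication by a nonzero torsion
-- polynomial, built by recursion on n. At x = y^n these relations say that V(y^n,y) A - A(y^n,y) V
-- has vanishing Taylor coefficients, up to the value of the torsion. Substituting y^n rather than a
-- scalar avoids a search for a point where the denominator survives, a search that undecidable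
-- equality would block; n is a multiple of m, so that invariance under τ passes to the values.
-- Being nonzero is a negation, so lowest terms are needed only up to double negation. Polynomials
-- are lists with repeated and cancelling monomials; passing to adjoints on weights reduces most
-- operator identities to single monomials.

-- Ring identities normalised with integer coefficients.

module IntegerSolver {c ℓ} (R : CommutativeRing c ℓ) where
  open CommutativeRing R
  open RingProperties ring using (-‿distribˡ-*; -‿distribʳ-*)
  open AbelianGroupProperties +-abelianGroup using (ε⁻¹≈ε; ⁻¹-∙-comm; ⁻¹-involutive)
  open Multiples semiring using (×-homo-+; ×1-homo-*) renaming (_×_ to _·_)
  open SetoidReasoning setoid

  private
    fromℤ : ℤ → Carrier
    fromℤ (+ n)    = n · 1#
    fromℤ -[1+ n ] = - (suc n · 1#)

    cancel : ∀ x y z → (x + y) + - (x + z) ≈ y + - z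
    cancel x y z = begin
      (x + y) + - (x + z)   ≈⟨ +-cong (+-comm y x) (⁻¹-∙-comm x z) ⟨
      (y + x) + (- x + - z) ≈⟨ +-assoc y x _ ⟩
      y + (x + (- x + - z)) ≈⟨ +-congˡ (+-assoc x (- x) (- z)) ⟨
      y + ((x + - x) + - z) ≈⟨ +-congˡ (+-congʳ (-‿inverseʳ x)) ⟩
      y + (0# + - z)        ≈⟨ +-congˡ (+-identityˡ _) ⟩
      y + - z               ∎

    ⊖-homo : ∀ m n → fromℤ (m ⊖ n) ≈ m · 1# + - (n · 1#)
    ⊖-homo m       zero    = sym (trans (+-congˡ ε⁻¹≈ε) (+-identityʳ _))
    ⊖-homo zero    (suc n) = sym (+-identityˡ _)
    ⊖-homo (suc m) (suc n) = begin
      fromℤ (suc m ⊖ suc n)          ≡⟨ ≡.cong fromℤ (ℤ.[1+m]⊖[1+n]≡m⊖n m n) ⟩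
      fromℤ (m ⊖ n)                  ≈⟨ ⊖-homo m n ⟩
      m · 1# + - (n · 1#)            ≈⟨ cancel 1# _ _ ⟨
      suc m · 1# + - (suc n · 1#)    ∎

    +-homo : ∀ i j → fromℤ (i ℤ.+ j) ≈ fromℤ i + fromℤ j
    +-homo (+ m)    (+ n)    = ×-homo-+ 1# m n
    +-homo (+ m)    -[1+ n ] = ⊖-homo m (suc n)
    +-homo -[1+ m ] (+ n)    = trans (⊖-homo n (suc m)) (+-comm _ _)
    +-homo -[1+ m ] -[1+ n ] = begin
      - (suc (suc (m ℕ.+ n)) · 1#)        ≡⟨ ≡.cong (λ k → - (suc k · 1#)) (ℕ-suc m n) ⟩
      - ((suc m ℕ.+ suc n) · 1#)          ≈⟨ -‿cong (×-homo-+ 1# (suc m) (suc n)) ⟩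
      - (suc m · 1# + suc n · 1#)         ≈⟨ ⁻¹-∙-comm _ _ ⟨
      - (suc m · 1#) + - (suc n · 1#)     ∎
      where
      ℕ-suc : ∀ m n → suc (m ℕ.+ n) ≡ m ℕ.+ suc n
      ℕ-suc zero    n = ≡.refl
      ℕ-suc (suc m) n = ≡.cong suc (ℕ-suc m n)

    *-homo : ∀ i j → fromℤ (i ℤ.* j) ≈ fromℤ i * fromℤ j
    *-homo (+ zero)    j           = sym (zeroˡ _)
    *-homo (+ suc m)   (+ zero)    = trans (reflexive (≡.cong fromℤ (ℤ.*-zeroʳ (+ suc m)))) (sym (zeroʳ _))
    *-homo (+ suc m)   (+ suc n)   = ×1-homo-* (suc m) (suc n)
    *-homo (+ suc m)   -[1+ n ]    = trans (-‿cong (×1-homo-* (suc m) (suc n))) (-‿distribʳ-* _ _)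
    *-homo -[1+ m ]    (+ zero)    = trans (reflexive (≡.cong fromℤ (ℤ.*-zeroʳ -[1+ m ]))) (sym (zeroʳ _))
    *-homo -[1+ m ]    (+ suc n)   = trans (-‿cong (×1-homo-* (suc m) (suc n))) (-‿distribˡ-* _ _)
    *-homo -[1+ m ]    -[1+ n ]    = begin
      (suc m ℕ.* suc n) · 1#              ≈⟨ ×1-homo-* (suc m) (suc n) ⟩
      (suc m · 1#) * (suc n · 1#)         ≈⟨ ⁻¹-involutive _ ⟨
      - - ((suc m · 1#) * (suc n · 1#))   ≈⟨ -‿cong (-‿distribʳ-* _ _) ⟩
      - ((suc m · 1#) * - (suc n · 1#))   ≈⟨ -‿distribˡ-* _ _ ⟩
      - (suc m · 1#) * - (suc n · 1#)     ∎

    -‿homo : ∀ i → fromℤ (ℤ.- i) ≈ - fromℤ i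
    -‿homo (+ zero)  = sym ε⁻¹≈ε
    -‿homo (+ suc n) = refl
    -‿homo -[1+ n ]  = sym (⁻¹-involutive _)

    homomorphism : ℤ.+-*-rawRing -Raw-AlmostCommutative⟶ fromCommutativeRing R
    homomorphism = record
      { ⟦_⟧ = fromℤ ; +-homo = +-homo ; *-homo = *-homo ; -‿homo = -‿homo
      ; 0-homo = refl ; 1-homo = +-identityʳ 1# }

    -- Coefficients are compared in ℤ, where equality is decidable; distinct integers may still
    -- agree in R, so the negative answer is only `nothing`.
    fromℤ-≟ : ∀ i j → Maybe (fromℤ i ≈ fromℤ j)
    fromℤ-≟ i j with i ℤ.≟ j
    ... | yes i≡j = just (reflexive (≡.cong fromℤ i≡j))
    ... | no  _   = nothing

  open RingSolver ℤ.+-*-rawRing (fromCommutativeRing R) homomorphism fromℤ-≟ public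
    using (solve; _:=_; _:+_; _:*_; :-_)

-- Polynomials paired with weights, and the polynomial ring.

module Pairing {c ℓ} (F : Field c ℓ) where
  open Over F
  open IntegerSolver commutativeRing
  open SetoidReasoning setoid

  Weight : Set c
  Weight = ℕ → ℕ → Carrier

  private variable
    φ ψ : Weight
    p r : Poly

  -- The linear functional a x^i y^j ↦ a φ(i,j); a linear operator on
  -- polynomials is handled through its adjoint on weights.
  ev : Weight → Poly → Carrier
  ev φ []                = 0#
  ev φ ((a , i , j) ∷ p) = a * φ i j + ev φ p

  ev-cong : (∀ i j → φ i j ≈ ψ i j) → ∀ p → ev φ p ≈ ev ψ p
  ev-cong φ≈ψ []                = refl
  ev-cong φ≈ψ ((a , i , j) ∷ p) = +-cong (*-congˡ (φ≈ψ i j)) (ev-cong φ≈ψ p)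

  ev-++ : ∀ φ p r → ev φ (p ++ r) ≈ ev φ p + ev φ r
  ev-++ φ []      r = sym (+-identityˡ _)
  ev-++ φ (_ ∷ p) r = trans (+-congˡ (ev-++ φ p r)) (sym (+-assoc _ _ _))

  ev-+ : ∀ φ ψ p → ev (λ i j → φ i j + ψ i j) p ≈ ev φ p + ev ψ p
  ev-+ φ ψ []                = sym (+-identityˡ _)
  ev-+ φ ψ ((a , i , j) ∷ p) = trans (+-congˡ (ev-+ φ ψ p))
    (solve 5 (λ a x y u v → a :* (x :+ y) :+ (u :+ v) := (a :* x :+ u) :+ (a :* y :+ v)) refl
      a (φ i j) (ψ i j) (ev φ p) (ev ψ p))

  ev-*ˡ : ∀ b φ p → ev (λ i j → b * φ i j) p ≈ b * ev φ p
  ev-*ˡ b φ []                = sym (zeroʳ b)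
  ev-*ˡ b φ ((a , i , j) ∷ p) = trans (+-congˡ (ev-*ˡ b φ p))
    (solve 4 (λ b a x u → a :* (b :* x) :+ b :* u := b :* (a :* x :+ u)) refl b a (φ i j) (ev φ p))

  ev-0 : (∀ i j → φ i j ≈ 0#) → ∀ p → ev φ p ≈ 0#
  ev-0 φ≈0 []                = refl
  ev-0 φ≈0 ((a , i , j) ∷ p) =
    trans (+-cong (trans (*-congˡ (φ≈0 i j)) (zeroʳ a)) (ev-0 φ≈0 p)) (+-identityˡ _)

  -- Interchange of two finite sums; commutativity of `_*P_` and multiplicativity of operators rest
  -- on it.
  ev-swap : ∀ (Φ : ℕ → ℕ → Weight) p r →
    ev (λ i j → ev (Φ i j) r) p ≈ ev (λ k l → ev (λ i j → Φ i j k l) p) r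
  ev-swap Φ []                r = sym (ev-0 (λ _ _ → refl) r)
  ev-swap Φ ((a , i , j) ∷ p) r = begin
    a * ev (Φ i j) r + ev (λ i j → ev (Φ i j) r) p
      ≈⟨ +-cong (sym (ev-*ˡ a (Φ i j) r)) (ev-swap Φ p r) ⟩
    ev (λ k l → a * Φ i j k l) r + ev (λ k l → ev (λ i j → Φ i j k l) p) r
      ≈⟨ ev-+ _ _ r ⟨
    ev (λ k l → a * Φ i j k l + ev (λ i j → Φ i j k l) p) r ∎

  ev-map : ∀ {g : Mono → Mono} {φ ψ} →
    (∀ a i j → ev φ (g (a , i , j) ∷ []) ≈ a * ψ i j) → ∀ p → ev φ (map g p) ≈ ev ψ p
  ev-map eq []                = refl
  ev-map eq ((a , i , j) ∷ p) =
    +-cong (trans (sym (+-identityʳ _)) (eq a i j)) (ev-map eq p)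

  ev-concatMap : ∀ {g : Mono → Poly} {φ ψ} →
    (∀ a i j → ev φ (g (a , i , j)) ≈ a * ψ i j) → ∀ p → ev φ (concatMap g p) ≈ ev ψ p
  ev-concatMap         eq []                = refl
  ev-concatMap {g} {φ} eq ((a , i , j) ∷ p) =
    trans (ev-++ φ (g (a , i , j)) _) (+-cong (eq a i j) (ev-concatMap eq p))

  δ : ℕ → ℕ → Carrier
  δ i k with i ℕ.≟ k
  ... | yes _ = 1#
  ... | no  _ = 0#

  δ-refl : ∀ i → δ i i ≈ 1#
  δ-refl i with i ℕ.≟ i
  ... | yes _  = refl
  ... | no i≢i = ⊥-elim (i≢i ≡.refl)

  δ-≢ : ∀ {i k} → ¬ (i ≡ k) → δ i k ≈ 0#
  δ-≢ {i} {k} i≢k with i ℕ.≟ k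
  ... | yes i≡k = ⊥-elim (i≢k i≡k)
  ... | no _    = refl

  δ₂ : ℕ → ℕ → Weight
  δ₂ i j k l = δ i k * δ j l

  coeff-∷ : ∀ a k l p i j → coeff ((a , k , l) ∷ p) i j ≈ a * δ₂ i j k l + coeff p i j
  coeff-∷ a k l p i j with i ℕ.≟ k | j ℕ.≟ l
  ... | yes _ | yes _ = +-congʳ (sym (trans (*-congˡ (*-identityˡ 1#)) (*-identityʳ a)))
  ... | yes _ | no  _ = sym (trans (+-congʳ (trans (*-congˡ (zeroʳ _)) (zeroʳ a))) (+-identityˡ _))
  ... | no  _ | yes _ = sym (trans (+-congʳ (trans (*-congˡ (zeroˡ _)) (zeroʳ a))) (+-identityˡ _))
  ... | no  _ | no  _ = sym (trans (+-congʳ (trans (*-congˡ (zeroˡ _)) (zeroʳ a))) (+-identityˡ _))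

  coeff-ev : ∀ p i j → coeff p i j ≈ ev (δ₂ i j) p
  coeff-ev []                i j = refl
  coeff-ev ((a , k , l) ∷ p) i j = trans (coeff-∷ a k l p i j) (+-congˡ (coeff-ev p i j))

  -- Read off the list, since a true degree would require deciding whether coefficients vanish. It
  -- exceeds every listed exponent in x and in y.
  bound : Poly → ℕ
  bound []                = 0
  bound ((_ , i , j) ∷ p) = suc (i ℕ.+ j ℕ.+ bound p)

  private
    i<bound : ∀ i j n → i < suc (i ℕ.+ j ℕ.+ n)
    i<bound i j n = s≤s (ℕ.≤-trans (ℕ.m≤m+n i j) (ℕ.m≤m+n _ n))

    j<bound : ∀ i j n → j < suc (i ℕ.+ j ℕ.+ n)
    j<bound i j n = s≤s (ℕ.≤-trans (ℕ.m≤n+m j i) (ℕ.m≤m+n _ n))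

    n<bound : ∀ i j n → n < suc (i ℕ.+ j ℕ.+ n)
    n<bound i j n = s≤s (ℕ.m≤n+m n (i ℕ.+ j))

  coeff-bound : ∀ p i j → bound p ≤ i ⊎ bound p ≤ j → coeff p i j ≈ 0#
  coeff-bound []                i j _ = refl
  coeff-bound ((a , k , l) ∷ p) i j b = trans (coeff-∷ a k l p i j)
    (trans (+-cong (trans (*-congˡ (off b)) (zeroʳ a)) (coeff-bound p i j (rest b))) (+-identityˡ _))
    where
    n = bound p
    off : suc (k ℕ.+ l ℕ.+ n) ≤ i ⊎ suc (k ℕ.+ l ℕ.+ n) ≤ j → δ₂ i j k l ≈ 0#
    off (inj₁ b≤i) = trans (*-congʳ (δ-≢ (ℕ.>⇒≢ (ℕ.≤-trans (i<bound k l n) b≤i)))) (zeroˡ _)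
    off (inj₂ b≤j) = trans (*-congˡ (δ-≢ (ℕ.>⇒≢ (ℕ.≤-trans (j<bound k l n) b≤j)))) (zeroʳ _)
    rest : suc (k ℕ.+ l ℕ.+ n) ≤ i ⊎ suc (k ℕ.+ l ℕ.+ n) ≤ j → n ≤ i ⊎ n ≤ j
    rest (inj₁ b≤i) = inj₁ (ℕ.≤-trans (ℕ.<⇒≤ (n<bound k l n)) b≤i)
    rest (inj₂ b≤j) = inj₂ (ℕ.≤-trans (ℕ.<⇒≤ (n<bound k l n)) b≤j)

  private
    sum-cong : ∀ n {f g : ℕ → Carrier} → (∀ i → f i ≈ g i) → sumK n f ≈ sumK n g
    sum-cong zero    f≈g = refl
    sum-cong (suc n) f≈g = +-cong (f≈g n) (sum-cong n f≈g)

    sum-0 : ∀ n {f : ℕ → Carrier} → (∀ i → i < n → f i ≈ 0#) → sumK n f ≈ 0#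
    sum-0 zero    f≈0 = refl
    sum-0 (suc n) f≈0 = trans
      (+-cong (f≈0 n (ℕ.n<1+n n)) (sum-0 n (λ i i<n → f≈0 i (ℕ.m<n⇒m<1+n i<n)))) (+-identityˡ _)

    sum-+ : ∀ n (f g : ℕ → Carrier) → sumK n (λ i → f i + g i) ≈ sumK n f + sumK n g
    sum-+ zero    f g = sym (+-identityˡ _)
    sum-+ (suc n) f g = trans (+-congˡ (sum-+ n f g))
      (solve 4 (λ a b u v → (a :+ b) :+ (u :+ v) := (a :+ u) :+ (b :+ v)) refl _ _ _ _)

    sum-δ : ∀ n {k} (f : ℕ → Carrier) → k < n → sumK n (λ i → δ i k * f i) ≈ f k
    sum-δ (suc n) {k} f k<1+n with n ℕ.≟ k
    ... | yes ≡.refl = trans (+-cong (*-identityˡ _)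
            (sum-0 n (λ i i<n → trans (*-congʳ (δ-≢ (ℕ.<⇒≢ i<n))) (zeroˡ _)))) (+-identityʳ _)
    ... | no  n≢k    = trans (+-cong (zeroˡ _)
            (sum-δ n f (ℕ.≤∧≢⇒< (ℕ.≤-pred k<1+n) (λ k≡n → n≢k (≡.sym k≡n))))) (+-identityˡ _)

    -- Regroups the list by exponents, so that the pairing is seen to depend on the coefficients
    -- alone, despite repeated or cancelling monomials.
    ev-sum : ∀ n φ p → bound p ≤ n →
      sumK n (λ i → sumK n (λ j → coeff p i j * φ i j)) ≈ ev φ p
    ev-sum n φ []                _   = sum-0 n (λ i _ → sum-0 n (λ j _ → zeroˡ _))
    ev-sum n φ ((a , k , l) ∷ p) b≤n = begin
      sumK n (λ i → sumK n (λ j → coeff ((a , k , l) ∷ p) i j * φ i j))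
        ≈⟨ sum-cong n (λ i → sum-cong n (λ j → trans (*-congʳ (coeff-∷ a k l p i j))
             (solve 5 (λ a x y c f → (a :* (x :* y) :+ c) :* f := y :* (x :* (a :* f)) :+ c :* f)
               refl a (δ i k) (δ j l) (coeff p i j) (φ i j)))) ⟩
      sumK n (λ i → sumK n (λ j → δ j l * (δ i k * (a * φ i j)) + coeff p i j * φ i j))
        ≈⟨ sum-cong n (λ i → trans (sum-+ n _ _)
             (+-congʳ (sum-δ n (λ j → δ i k * (a * φ i j)) (ℕ.≤-trans (j<bound k l _) b≤n)))) ⟩
      sumK n (λ i → δ i k * (a * φ i l) + sumK n (λ j → coeff p i j * φ i j))
        ≈⟨ trans (sum-+ n _ _)
             (+-congʳ (sum-δ n (λ i → a * φ i l) (ℕ.≤-trans (i<bound k l _) b≤n))) ⟩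
      a * φ k l + sumK n (λ i → sumK n (λ j → coeff p i j * φ i j))
        ≈⟨ +-congˡ (ev-sum n φ p (ℕ.≤-trans (ℕ.<⇒≤ (n<bound k l _)) b≤n)) ⟩
      a * φ k l + ev φ p ∎

  ev-vanish : ∀ φ p → (∀ i j → coeff p i j ≈ 0# ⊎ φ i j ≈ 0#) → ev φ p ≈ 0#
  ev-vanish φ p cφ≈0 = trans (sym (ev-sum (bound p) φ p ℕ.≤-refl))
    (sum-0 (bound p) (λ i _ → sum-0 (bound p) (λ j _ → term (cφ≈0 i j))))
    where
    term : ∀ {i j} → coeff p i j ≈ 0# ⊎ φ i j ≈ 0# → coeff p i j * φ i j ≈ 0#
    term (inj₁ c≈0) = trans (*-congʳ c≈0) (zeroˡ _)
    term (inj₂ φ≈0) = trans (*-congˡ φ≈0) (zeroʳ _)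

  open RingProperties ring public using (-1*x≈-x)

  x-y≈0⇒x≈y : ∀ {x y} → x + - y ≈ 0# → x ≈ y
  x-y≈0⇒x≈y {x} {y} x-y≈0 = begin
    x             ≈⟨ solve 2 (λ x y → x := (x :+ :- y) :+ y) refl x y ⟩
    (x + - y) + y ≈⟨ +-congʳ x-y≈0 ⟩
    0# + y        ≈⟨ +-identityˡ y ⟩
    y             ∎

  x≈y⇒x-y≈0 : ∀ {x y} → x ≈ y → x + - y ≈ 0#
  x≈y⇒x-y≈0 x≈y = trans (+-congʳ x≈y) (-‿inverseʳ _)

  -- The pairing sees a weight only where the polynomial has a coefficient: `ev-vanish` applies to
  -- the difference of the weights.
  ev-agree : ∀ φ ψ p → (∀ i j → coeff p i j ≈ 0# ⊎ φ i j ≈ ψ i j) → ev φ p ≈ ev ψ p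
  ev-agree φ ψ p agree = x-y≈0⇒x≈y (begin
    ev φ p + - ev ψ p                  ≈⟨ +-congˡ (trans (sym (-1*x≈-x _)) (sym (ev-*ˡ (- 1#) ψ p))) ⟩
    ev φ p + ev (λ i j → - 1# * ψ i j) p ≈⟨ ev-+ _ _ p ⟨
    ev (λ i j → φ i j + - 1# * ψ i j) p  ≈⟨ ev-vanish _ p (λ i j → diff (agree i j)) ⟩
    0#                                 ∎)
    where
    diff : ∀ {i j} → coeff p i j ≈ 0# ⊎ φ i j ≈ ψ i j →
           coeff p i j ≈ 0# ⊎ φ i j + - 1# * ψ i j ≈ 0#
    diff (inj₁ c≈0) = inj₁ c≈0
    diff (inj₂ φ≈ψ) = inj₂ (trans (+-congˡ (-1*x≈-x _)) (x≈y⇒x-y≈0 φ≈ψ))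

  -- A record, so that Agda can infer p and r from a proof of p ≋ r.
  record _≋_ (p r : Poly) : Set (c ⊔ ℓ) where
    constructor by-ev
    field at : ∀ φ → ev φ p ≈ ev φ r
  open _≋_ public

  infix 4 _≋_

  ≋⇒≈P : p ≋ r → p ≈P r
  ≋⇒≈P {p} {r} p≋r i j = trans (coeff-ev p i j) (trans (at p≋r _) (sym (coeff-ev r i j)))

  ev--P : ∀ φ p → ev φ (-P p) ≈ - ev φ p
  ev--P φ p = trans (ev-map (λ a i j → trans (+-identityʳ _)
      (solve 2 (λ a x → :- a :* x := a :* :- x) refl a (φ i j))) p)
    (trans (ev-cong (λ i j → sym (-1*x≈-x _)) p) (trans (ev-*ˡ (- 1#) φ p) (-1*x≈-x _)))

  ev-*P : ∀ φ p r → ev φ (p *P r) ≈ ev (λ i j → ev (λ k l → φ (i ℕ.+ k) (j ℕ.+ l)) r) p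
  ev-*P φ p r = ev-concatMap (λ a i j → trans
    (ev-map (λ b k l → trans (+-identityʳ _)
      (solve 3 (λ a b x → (a :* b) :* x := b :* (a :* x)) refl a b (φ (i ℕ.+ k) (j ℕ.+ l)))) r)
    (ev-*ˡ a _ r)) p

  ≈P⇒≋ : p ≈P r → p ≋ r
  ≈P⇒≋ {p} {r} p≈r = by-ev λ φ → x-y≈0⇒x≈y (begin
    ev φ p + - ev φ r      ≈⟨ trans (ev-++ φ p _) (+-congˡ (ev--P φ r)) ⟨
    ev φ (p +P (-P r))     ≈⟨ ev-vanish φ (p +P (-P r)) (λ i j → inj₁ (begin
        coeff (p +P (-P r)) i j             ≈⟨ coeff-ev (p +P (-P r)) i j ⟩
        ev (δ₂ i j) (p +P (-P r))           ≈⟨ trans (ev-++ _ p _) (+-congˡ (ev--P _ r)) ⟩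
        ev (δ₂ i j) p + - ev (δ₂ i j) r     ≈⟨ +-cong (coeff-ev p i j) (-‿cong (coeff-ev r i j)) ⟨
        coeff p i j + - coeff r i j         ≈⟨ x≈y⇒x-y≈0 (p≈r i j) ⟩
        0#                                  ∎)) ⟩
    0#                     ∎)

  ≋-refl : p ≋ p
  ≋-refl = by-ev λ _ → refl

  ≋-sym : p ≋ r → r ≋ p
  ≋-sym p≋r = by-ev λ φ → sym (at p≋r φ)

  ≋-trans : ∀ {s} → p ≋ r → r ≋ s → p ≋ s
  ≋-trans p≋r r≋s = by-ev λ φ → trans (at p≋r φ) (at r≋s φ)

  private
    *P-cong : ∀ {p p' r r'} → p ≋ p' → r ≋ r' → p *P r ≋ p' *P r'
    *P-cong {p} {p'} {r} {r'} p≋ r≋ = by-ev λ φ → begin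
      ev φ (p *P r)   ≈⟨ ev-*P φ p r ⟩
      ev (λ i j → ev (λ k l → φ (i ℕ.+ k) (j ℕ.+ l)) r) p   ≈⟨ ev-cong (λ i j → at r≋ _) p ⟩
      ev (λ i j → ev (λ k l → φ (i ℕ.+ k) (j ℕ.+ l)) r') p  ≈⟨ at p≋ _ ⟩
      ev (λ i j → ev (λ k l → φ (i ℕ.+ k) (j ℕ.+ l)) r') p' ≈⟨ ev-*P φ p' r' ⟨
      ev φ (p' *P r') ∎

    *P-comm : ∀ p r → p *P r ≋ r *P p
    *P-comm p r = by-ev λ φ → begin
      ev φ (p *P r)                                         ≈⟨ ev-*P φ p r ⟩
      ev (λ i j → ev (λ k l → φ (i ℕ.+ k) (j ℕ.+ l)) r) p   ≈⟨ ev-swap _ p r ⟩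
      ev (λ k l → ev (λ i j → φ (i ℕ.+ k) (j ℕ.+ l)) p) r
        ≈⟨ ev-cong (λ k l → ev-cong (λ i j → reflexive (≡.cong₂ φ (ℕ.+-comm i k) (ℕ.+-comm j l))) p) r ⟩
      ev (λ k l → ev (λ i j → φ (k ℕ.+ i) (l ℕ.+ j)) p) r   ≈⟨ ev-*P φ r p ⟨
      ev φ (r *P p)                                         ∎

    *P-assoc : ∀ p r s → (p *P r) *P s ≋ p *P (r *P s)
    *P-assoc p r s = by-ev λ φ → begin
      ev φ ((p *P r) *P s)                                  ≈⟨ ev-*P φ (p *P r) s ⟩
      ev (λ i j → ev (λ k l → φ (i ℕ.+ k) (j ℕ.+ l)) s) (p *P r) ≈⟨ ev-*P _ p r ⟩
      ev (λ i j → ev (λ u v → ev (λ k l → φ (i ℕ.+ u ℕ.+ k) (j ℕ.+ v ℕ.+ l)) s) r) p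
        ≈⟨ ev-cong (λ i j → trans (ev-cong (λ u v → ev-cong (λ k l →
             reflexive (≡.cong₂ φ (ℕ.+-assoc i u k) (ℕ.+-assoc j v l))) s) r) (sym (ev-*P _ r s))) p ⟩
      ev (λ i j → ev (λ k l → φ (i ℕ.+ k) (j ℕ.+ l)) (r *P s)) p ≈⟨ ev-*P φ p (r *P s) ⟨
      ev φ (p *P (r *P s)) ∎

    *P-identityˡ : ∀ p → 1P *P p ≋ p
    *P-identityˡ p = by-ev λ φ → begin
      ev φ (1P *P p)    ≈⟨ ev-*P φ 1P p ⟩
      1# * ev φ p + 0#  ≈⟨ trans (+-identityʳ _) (*-identityˡ _) ⟩
      ev φ p            ∎

    *P-distribʳ : ∀ s p r → (p +P r) *P s ≋ (p *P s) +P (r *P s)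
    *P-distribʳ s p r = by-ev λ φ → begin
      ev φ ((p +P r) *P s)             ≈⟨ ev-*P φ (p +P r) s ⟩
      ev _ (p +P r)                    ≈⟨ ev-++ _ p r ⟩
      ev _ p + ev _ r                  ≈⟨ +-cong (ev-*P φ p s) (ev-*P φ r s) ⟨
      ev φ (p *P s) + ev φ (r *P s)    ≈⟨ ev-++ φ (p *P s) (r *P s) ⟨
      ev φ ((p *P s) +P (r *P s))      ∎

    +P-comm : ∀ p r → p +P r ≋ r +P p
    +P-comm p r = by-ev λ φ → trans (ev-++ φ p r) (trans (+-comm _ _) (sym (ev-++ φ r p)))

    -P-inverseˡ : ∀ p → (-P p) +P p ≋ 0P
    -P-inverseˡ p = by-ev λ φ → trans (ev-++ φ (-P p) p) (trans (+-congʳ (ev--P φ p)) (-‿inverseˡ _))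

  polynomialRing : CommutativeRing c (c ⊔ ℓ)
  polynomialRing = record
    { Carrier = Poly ; _≈_ = _≋_ ; _+_ = _+P_ ; _*_ = _*P_ ; -_ = -P_ ; 0# = 0P ; 1# = 1P
    ; isCommutativeRing = record
      { isRing = record
        { +-isAbelianGroup = record
          { isGroup = record
            { isMonoid = record
              { isSemigroup = record
                { isMagma = record
                  { isEquivalence = record { refl = ≋-refl ; sym = ≋-sym ; trans = ≋-trans }
                  ; ∙-cong = λ {p} {p'} {r} {r'} p≋ r≋ → by-ev λ φ → trans (ev-++ φ p r)
                      (trans (+-cong (at p≋ φ) (at r≋ φ)) (sym (ev-++ φ p' r'))) }
                ; assoc = λ p r s → by-ev λ φ → reflexive (≡.cong (ev φ) (List.++-assoc p r s)) }
              ; identity = (λ _ → ≋-refl)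
                , (λ p → by-ev λ φ → reflexive (≡.cong (ev φ) (List.++-identityʳ p))) }
            ; inverse = -P-inverseˡ , (λ p → ≋-trans (+P-comm p (-P p)) (-P-inverseˡ p))
            ; ⁻¹-cong = λ {p} {r} p≋r → by-ev λ φ →
                trans (ev--P φ p) (trans (-‿cong (at p≋r φ)) (sym (ev--P φ r))) }
          ; comm = +P-comm }
        ; *-cong = *P-cong
        ; *-assoc = *P-assoc
        ; *-identity = *P-identityˡ , (λ p → ≋-trans (*P-comm p 1P) (*P-identityˡ p))
        ; distrib = (λ s p r → ≋-trans (*P-comm s (p +P r)) (≋-trans (*P-distribʳ s p r)
              (by-ev λ φ → trans (ev-++ φ (p *P s) (r *P s)) (trans (+-cong (at (*P-comm p s) φ) (at (*P-comm r s) φ))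
                 (sym (ev-++ φ (s *P p) (s *P r)))))))
            , *P-distribʳ }
      ; *-comm = *P-comm } }

-- A least counterexample. P is not decidable, so it is obtained only up to double negation; the
-- tail hypothesis bounds the search by n.
minimal-¬¬ : ∀ {ℓ} (P : ℕ → Set ℓ) n → (∀ k → n ≤ k → P k) → ¬ (∀ k → P k) →
  ¬ ¬ (∃ λ i → ¬ P i × (∀ k → k < i → P k))
minimal-¬¬ P n tail ¬all ¬min = below n λ P<n → ¬all λ k → decide k P<n
  where
  below : ∀ m → ¬ ¬ (∀ k → k < m → P k)
  below zero    h = h λ _ ()
  below (suc m) h = below m λ P<m → ¬min (m , (λ Pm → h λ k k<1+m → extend k k<1+m P<m Pm) , P<m)
    where
    extend : ∀ k → k < suc m → (∀ k → k < m → P k) → P m → P k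
    extend k k<1+m P<m Pm with k ℕ.≟ m
    ... | yes ≡.refl = Pm
    ... | no  k≢m    = P<m k (ℕ.≤∧≢⇒< (ℕ.≤-pred k<1+m) k≢m)
  decide : ∀ k → (∀ k → k < n → P k) → P k
  decide k P<n with k ℕ.<? n
  ... | yes k<n = P<n k k<n
  ... | no  k≮n = tail k (ℕ.≮⇒≥ k≮n)

-- Products of nonzero polynomials; operators with an adjoint.

module Operators {c ℓ} (F : Field c ℓ) where
  open Over F
  open Pairing F
  open IntegerSolver commutativeRing
  open SetoidReasoning setoid

  -- Scalars, unlike polynomials, can be cancelled, because `inverse` supplies a witness for every
  -- nonzero one.
  cancel-nonzero : ∀ {u x} → ¬ u ≈ 0# → u * x ≈ 0# → x ≈ 0#
  cancel-nonzero {u} {x} u≉0 ux≈0 with inverse u u≉0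
  ... | v , uv≈1 = begin
    x           ≈⟨ *-identityˡ x ⟨
    1# * x      ≈⟨ *-congʳ uv≈1 ⟨
    (u * v) * x ≈⟨ solve 3 (λ u v x → (u :* v) :* x := v :* (u :* x)) refl u v x ⟩
    v * (u * x) ≈⟨ *-congˡ ux≈0 ⟩
    v * 0#      ≈⟨ zeroʳ v ⟩
    0#          ∎

  record NonZero (p : Poly) : Set ℓ where
    constructor nonzero
    field nonzeroP : NonZeroP p
  open NonZero public

  NonZero-≋ : ∀ {p r} → (p ≋ 0P → r ≋ 0P) → NonZero r → NonZero p
  NonZero-≋ {p} {r} p⇒r (nonzero r≉0) = nonzero λ p≈0 → r≉0 (≋⇒≈P (p⇒r (≈P⇒≋ {p} {0P} p≈0)))

  NonZero-1 : NonZero 1P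
  NonZero-1 = nonzero λ 1≈0 → 0≉1 (sym (trans (sym (+-identityʳ 1#)) (1≈0 0 0)))

  record LowestTerm (p : Poly) : Set ℓ where
    field
      i j      : ℕ
      coeff≉0  : ¬ coeff p i j ≈ 0#
      rows     : ∀ k → k < i → ∀ l → coeff p k l ≈ 0#
      columns  : ∀ l → l < j → coeff p i l ≈ 0#

  lowestTerm : ∀ {p} → NonZero p → ¬ ¬ LowestTerm p
  lowestTerm {p} (nonzero p≉0) h =
    minimal-¬¬ (λ i → ∀ j → coeff p i j ≈ 0#) (bound p) (λ k b≤k l → coeff-bound p k l (inj₁ b≤k)) p≉0
      λ (i , row≉0 , rows) →
    minimal-¬¬ (λ j → coeff p i j ≈ 0#) (bound p) (λ l b≤l → coeff-bound p i l (inj₂ b≤l)) row≉0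
      λ (j , coeff≉0 , columns) →
    h record { i = i ; j = j ; coeff≉0 = coeff≉0 ; rows = rows ; columns = columns }

  δ-+ : ∀ n i k → δ (n ℕ.+ i) (n ℕ.+ k) ≈ δ i k
  δ-+ n i k with i ℕ.≟ k
  ... | yes ≡.refl = δ-refl (n ℕ.+ i)
  ... | no  i≢k    = δ-≢ (i≢k ∘ ℕ.+-cancelˡ-≡ n i k)

  -- Lowest means lexicographic, x before y. This order is compatible with addition of exponents, so
  -- the two lowest monomials are the only pair that contributes.
  coeff-lowest : ∀ {p r} (s : LowestTerm p) (t : LowestTerm r) →
    coeff (p *P r) (LowestTerm.i s ℕ.+ LowestTerm.i t) (LowestTerm.j s ℕ.+ LowestTerm.j t) ≈
    coeff r (LowestTerm.i t) (LowestTerm.j t) * coeff p (LowestTerm.i s) (LowestTerm.j s)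
  coeff-lowest {p} {r} s t = begin
    coeff (p *P r) (i ℕ.+ i') (j ℕ.+ j')          ≈⟨ coeff-ev (p *P r) _ _ ⟩
    ev (δ₂ (i ℕ.+ i') (j ℕ.+ j')) (p *P r)        ≈⟨ ev-*P _ p r ⟩
    ev ψ p                                        ≈⟨ ev-agree _ _ p agree ⟩
    ev (λ k l → coeff r i' j' * δ₂ i j k l) p     ≈⟨ ev-*ˡ _ _ p ⟩
    coeff r i' j' * ev (δ₂ i j) p                 ≈⟨ *-congˡ (coeff-ev p i j) ⟨
    coeff r i' j' * coeff p i j                   ∎
    where
    open LowestTerm s
    open LowestTerm t using () renaming (i to i'; j to j'; rows to rows'; columns to columns')
    ψ : Weight
    ψ k l = ev (λ k' l' → δ₂ (i ℕ.+ i') (j ℕ.+ j') (k ℕ.+ k') (l ℕ.+ l')) r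
    left : ∀ a b k l → ¬ a ≡ k → δ₂ a b k l ≈ 0#
    left a b k l a≢k = trans (*-congʳ (δ-≢ a≢k)) (zeroˡ (δ b l))
    right : ∀ a b k l → ¬ b ≡ l → δ₂ a b k l ≈ 0#
    right a b k l b≢l = trans (*-congˡ (δ-≢ b≢l)) (zeroʳ (δ a k))
    off : ∀ {x k l} → δ₂ i j k l ≈ 0# → x ≈ 0# → x ≈ coeff r i' j' * δ₂ i j k l
    off δ≈0 x≈0 = trans x≈0 (sym (trans (*-congˡ δ≈0) (zeroʳ _)))
    agree : ∀ k l → coeff p k l ≈ 0# ⊎ ψ k l ≈ coeff r i' j' * δ₂ i j k l
    agree k l with ℕ.<-cmp k i | ℕ.<-cmp l j
    ... | tri< k<i _ _     | _            = inj₁ (rows k k<i l)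
    ... | tri≈ _ ≡.refl _  | tri< l<j _ _ = inj₁ (columns l l<j)
    ... | tri≈ _ ≡.refl _  | tri≈ _ ≡.refl _ = inj₂ (begin
      ψ k l                  ≈⟨ ev-cong (λ k' l' → *-cong (δ-+ k i' k') (δ-+ l j' l')) r ⟩
      ev (δ₂ i' j') r        ≈⟨ coeff-ev r i' j' ⟨
      coeff r i' j'          ≈⟨ *-identityʳ _ ⟨
      coeff r i' j' * 1#     ≈⟨ *-congˡ (trans (*-cong (δ-refl k) (δ-refl l)) (*-identityˡ 1#)) ⟨
      coeff r i' j' * δ₂ k l k l ∎)
    -- Since l exceeds j, only an exponent below j' could complete the sum j + j', and there row i'
    -- of r is empty.
    ... | tri≈ _ ≡.refl _  | tri> _ _ j<l = inj₂ (off (right i j k l (ℕ.<⇒≢ j<l)) (ev-vanish _ r vanish))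
      where
      vanish : ∀ k' l' → coeff r k' l' ≈ 0# ⊎ δ₂ (i ℕ.+ i') (j ℕ.+ j') (k ℕ.+ k') (l ℕ.+ l') ≈ 0#
      vanish k' l' with k' ℕ.≟ i' | l' ℕ.<? j'
      ... | no k'≢i'   | _         = inj₂ (left (i ℕ.+ i') (j ℕ.+ j') (k ℕ.+ k') (l ℕ.+ l') (k'≢i' ∘ ≡.sym ∘ ℕ.+-cancelˡ-≡ k i' k'))
      ... | yes ≡.refl | yes l'<j' = inj₁ (columns' l' l'<j')
      ... | yes ≡.refl | no  l'≮j' = inj₂ (right (i ℕ.+ i') (j ℕ.+ j') (k ℕ.+ k') (l ℕ.+ l') (ℕ.<⇒≢ (ℕ.+-mono-<-≤ j<l (ℕ.≮⇒≥ l'≮j'))))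
    ... | tri> _ _ i<k     | _            = inj₂ (off (left i j k l (ℕ.<⇒≢ i<k)) (ev-vanish _ r vanish))
      where
      vanish : ∀ k' l' → coeff r k' l' ≈ 0# ⊎ δ₂ (i ℕ.+ i') (j ℕ.+ j') (k ℕ.+ k') (l ℕ.+ l') ≈ 0#
      vanish k' l' with k' ℕ.<? i'
      ... | yes k'<i' = inj₁ (rows' k' k'<i' l')
      ... | no  k'≮i' = inj₂ (left (i ℕ.+ i') (j ℕ.+ j') (k ℕ.+ k') (l ℕ.+ l') (ℕ.<⇒≢ (ℕ.+-mono-<-≤ i<k (ℕ.≮⇒≥ k'≮i'))))

  -- The claim is a negation, so the doubly negated lowest terms may be used.
  NonZero-* : ∀ {p r} → NonZero p → NonZero r → NonZero (p *P r)
  NonZero-* {p} {r} p≉0 r≉0 = nonzero λ pr≈0 →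
    lowestTerm p≉0 λ s → lowestTerm r≉0 λ t →
    LowestTerm.coeff≉0 s (cancel-nonzero (LowestTerm.coeff≉0 t)
      (trans (sym (coeff-lowest s t)) (pr≈0 _ _)))

  -- Additivity and compatibility with equality follow from the mere existence of an adjoint, with
  -- no reference to how L acts on lists.
  record Adjoint (L : Poly → Poly) : Set (c ⊔ ℓ) where
    field
      adjoint    : Weight → Weight
      ev-adjoint : ∀ φ p → ev φ (L p) ≈ ev (adjoint φ) p

    cong : ∀ {p r} → p ≋ r → L p ≋ L r
    cong {p} {r} p≋r = by-ev λ φ → trans (ev-adjoint φ p) (trans (at p≋r _) (sym (ev-adjoint φ r)))

    +-homo : ∀ p r → L (p +P r) ≋ L p +P L r
    +-homo p r = by-ev λ φ → begin
      ev φ (L (p +P r))                         ≈⟨ trans (ev-adjoint φ (p +P r)) (ev-++ _ p r) ⟩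
      ev (adjoint φ) p + ev (adjoint φ) r       ≈⟨ +-cong (ev-adjoint φ p) (ev-adjoint φ r) ⟨
      ev φ (L p) + ev φ (L r)                   ≈⟨ ev-++ φ (L p) (L r) ⟨
      ev φ (L p +P L r)                         ∎

    -‿homo : ∀ p → L (-P p) ≋ -P L p
    -‿homo p = by-ev λ φ → begin
      ev φ (L (-P p))        ≈⟨ trans (ev-adjoint φ (-P p)) (ev--P _ p) ⟩
      - ev (adjoint φ) p     ≈⟨ -‿cong (ev-adjoint φ p) ⟨
      - ev φ (L p)           ≈⟨ ev--P φ (L p) ⟨
      ev φ (-P L p)          ∎

    0-homo : L 0P ≋ 0P
    0-homo = by-ev λ φ → ev-adjoint φ 0P

    coeff-adjoint : ∀ p i j → coeff (L p) i j ≈ ev (adjoint (δ₂ i j)) p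
    coeff-adjoint p i j = trans (coeff-ev (L p) i j) (ev-adjoint _ p)

  open Adjoint

  -- The premise is multiplicativity on a pair of monomials; two interchanges of summation extend it
  -- to polynomials.
  *-homo-from : ∀ {L} (A : Adjoint L) →
    (∀ φ i j k l → adjoint A φ (i ℕ.+ k) (j ℕ.+ l) ≈
       adjoint A (λ k' l' → adjoint A (λ i' j' → φ (i' ℕ.+ k') (j' ℕ.+ l')) i j) k l) →
    ∀ p r → L (p *P r) ≋ L p *P L r
  *-homo-from {L} A split p r = by-ev λ φ → begin
    ev φ (L (p *P r))
      ≈⟨ trans (ev-adjoint A φ (p *P r)) (ev-*P _ p r) ⟩
    ev (λ i j → ev (λ k l → adjoint A φ (i ℕ.+ k) (j ℕ.+ l)) r) p
      ≈⟨ ev-cong (λ i j → trans (ev-cong (split φ i j) r) (sym (ev-adjoint A _ r))) p ⟩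
    ev (λ i j → ev (λ k' l' → adjoint A (λ i' j' → φ (i' ℕ.+ k') (j' ℕ.+ l')) i j) (L r)) p
      ≈⟨ ev-swap _ p (L r) ⟩
    ev (λ k' l' → ev (adjoint A (λ i' j' → φ (i' ℕ.+ k') (j' ℕ.+ l'))) p) (L r)
      ≈⟨ ev-cong (λ k' l' → sym (ev-adjoint A _ p)) (L r) ⟩
    ev (λ k' l' → ev (λ i' j' → φ (i' ℕ.+ k') (j' ℕ.+ l')) (L p)) (L r)
      ≈⟨ ev-swap _ (L p) (L r) ⟨
    ev (λ i' j' → ev (λ k' l' → φ (i' ℕ.+ k') (j' ℕ.+ l')) (L r)) (L p)
      ≈⟨ ev-*P φ (L p) (L r) ⟨
    ev φ (L p *P L r) ∎

  commute : ∀ {L M} (A : Adjoint L) (B : Adjoint M) →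
    (∀ φ i j → adjoint B (adjoint A φ) i j ≈ adjoint A (adjoint B φ) i j) →
    ∀ p → L (M p) ≋ M (L p)
  commute {L} {M} A B eq p = by-ev λ φ → begin
    ev φ (L (M p))                 ≈⟨ trans (ev-adjoint A φ (M p)) (ev-adjoint B _ p) ⟩
    ev (adjoint B (adjoint A φ)) p ≈⟨ ev-cong (eq φ) p ⟩
    ev (adjoint A (adjoint B φ)) p ≈⟨ trans (ev-adjoint B φ (L p)) (ev-adjoint A _ p) ⟨
    ev φ (M (L p))                 ∎

  -- Row i of L p involves only the rows of p from s + i upwards, and row s + i with the nonzero
  -- factor u i. Hence the rows of p vanish one after another from the top. For s = 0 this gives
  -- injectivity, for s = 1 the kernel of an operator that lowers the degree in x.
  triangular-kernel : ∀ {L} (A : Adjoint L) s (u : ℕ → Carrier) → (∀ i → ¬ u i ≈ 0#) →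
    (∀ i j k l → k < s ℕ.+ i → adjoint A (δ₂ i j) k l ≈ 0#) →
    (∀ i j l → adjoint A (δ₂ i j) (s ℕ.+ i) l ≈ u i * δ₂ (s ℕ.+ i) j (s ℕ.+ i) l) →
    ∀ {p} → L p ≋ 0P → ∀ i j → coeff p (s ℕ.+ i) j ≈ 0#
  triangular-kernel {L} A s u u≉0 below diagonal {p} Lp≋0 i =
    descend (bound p) i (ℕ.m≤n⇒m≤o+n (s ℕ.+ i) ℕ.≤-refl)
    where
    descend : ∀ d i → bound p ≤ s ℕ.+ i ℕ.+ d → ∀ j → coeff p (s ℕ.+ i) j ≈ 0#
    descend zero    i b≤ j = coeff-bound p _ j (inj₁ (ℕ.≤-trans b≤ (ℕ.≤-reflexive (ℕ.+-identityʳ _))))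
    descend (suc d) i b≤ j = cancel-nonzero (u≉0 i) (begin
      u i * coeff p (s ℕ.+ i) j                    ≈⟨ *-congˡ (coeff-ev p _ j) ⟩
      u i * ev (δ₂ (s ℕ.+ i) j) p                  ≈⟨ ev-*ˡ (u i) _ p ⟨
      ev (λ k l → u i * δ₂ (s ℕ.+ i) j k l) p      ≈⟨ ev-agree _ _ p agree ⟩
      ev (adjoint A (δ₂ i j)) p                    ≈⟨ coeff-adjoint A p i j ⟨
      coeff (L p) i j                              ≈⟨ ≋⇒≈P Lp≋0 i j ⟩
      0#                                           ∎)
      where
      agree : ∀ k l → coeff p k l ≈ 0# ⊎ u i * δ₂ (s ℕ.+ i) j k l ≈ adjoint A (δ₂ i j) k l
      agree k l with ℕ.<-cmp k (s ℕ.+ i)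
      ... | tri< k<s+i _ _    = inj₂ (trans
              (trans (*-congˡ (trans (*-congʳ (δ-≢ (ℕ.>⇒≢ k<s+i))) (zeroˡ _))) (zeroʳ _))
              (sym (below i j k l k<s+i)))
      ... | tri≈ _ ≡.refl _   = inj₂ (sym (diagonal i j l))
      ... | tri> _ _ s+i<k    = inj₁ (≡.subst (λ k → coeff p k l ≈ 0#) k≡
              (descend d (suc i ℕ.+ e) (ℕ.≤-trans b≤ (ℕ.≤-trans (ℕ.≤-reflexive (ℕ.+-suc _ d))
                 (ℕ.+-monoˡ-≤ d (ℕ.≤-trans s+i<k (ℕ.≤-reflexive (≡.sym k≡)))))) l))
        where
        e = k ∸ suc (s ℕ.+ i)
        k≡ : s ℕ.+ (suc i ℕ.+ e) ≡ k
        k≡ = ≡.trans (≡.sym (ℕ.+-assoc s (suc i) e))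
          (≡.trans (≡.cong (ℕ._+ e) (ℕ.+-suc s i)) (ℕ.m+[n∸m]≡n s+i<k))

  NonZero-triangular : ∀ {L} (A : Adjoint L) (u : ℕ → Carrier) → (∀ i → ¬ u i ≈ 0#) →
    (∀ i j k l → k < i → adjoint A (δ₂ i j) k l ≈ 0#) →
    (∀ i j l → adjoint A (δ₂ i j) i l ≈ u i * δ₂ i j i l) →
    ∀ {p} → NonZero p → NonZero (L p)
  NonZero-triangular A u u≉0 below diagonal {p} = NonZero-≋ λ Lp≋0 →
    ≈P⇒≋ {p} {0P} (triangular-kernel A 0 u u≉0 below diagonal Lp≋0)

-- Dilations, derivative, shift and substitution through their adjoints.

module ConcreteOperators {c ℓ} (F : Field c ℓ) where
  open Over F
  open Pairing F
  open Operators F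
  open Adjoint
  open IntegerSolver commutativeRing
  open SetoidReasoning setoid

  module P = CommutativeRing polynomialRing
  module PSolver = IntegerSolver polynomialRing

  pow-cong : ∀ {a b} n → a ≈ b → pow a n ≈ pow b n
  pow-cong zero    a≈b = refl
  pow-cong (suc n) a≈b = *-cong a≈b (pow-cong n a≈b)

  pow-1 : ∀ n → pow 1# n ≈ 1#
  pow-1 zero    = refl
  pow-1 (suc n) = trans (*-identityˡ _) (pow-1 n)

  pow-+ : ∀ a m n → pow a (m ℕ.+ n) ≈ pow a m * pow a n
  pow-+ a zero    n = sym (*-identityˡ _)
  pow-+ a (suc m) n = trans (*-congˡ (pow-+ a m n)) (sym (*-assoc _ _ _))

  pow-* : ∀ a m n → pow a (m ℕ.* n) ≈ pow (pow a n) m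
  pow-* a zero    n = refl
  pow-* a (suc m) n = trans (pow-+ a n (m ℕ.* n)) (*-congˡ (pow-* a m n))

  pow-≉0 : ∀ {a} → ¬ a ≈ 0# → ∀ n → ¬ pow a n ≈ 0#
  pow-≉0 a≉0 zero    1≈0  = 0≉1 (sym 1≈0)
  pow-≉0 a≉0 (suc n) aⁿ≈0 = pow-≉0 a≉0 n (cancel-nonzero a≉0 aⁿ≈0)

  ι-+ : ∀ m n → ι (m ℕ.+ n) ≈ ι m + ι n
  ι-+ zero    n = sym (+-identityˡ _)
  ι-+ (suc m) n = trans (+-congˡ (ι-+ m n)) (sym (+-assoc _ _ _))

  1≉0 : ¬ 1# ≈ 0#
  1≉0 1≈0 = 0≉1 (sym 1≈0)

  id-adjoint : Adjoint id
  id-adjoint = record { adjoint = id ; ev-adjoint = λ _ _ → refl }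

  difference-adjoint : ∀ {L} → Adjoint L → Adjoint (λ p → L p +P (-P p))
  difference-adjoint {L} A = record
    { adjoint    = λ φ i j → adjoint A φ i j + - 1# * φ i j
    ; ev-adjoint = λ φ p → begin
        ev φ (L p +P (-P p))                           ≈⟨ trans (ev-++ φ (L p) (-P p)) (+-congˡ (ev--P φ p)) ⟩
        ev φ (L p) + - ev φ p                          ≈⟨ +-cong (ev-adjoint A φ p) (trans (sym (-1*x≈-x _)) (sym (ev-*ˡ _ φ p))) ⟩
        ev (adjoint A φ) p + ev (λ i j → - 1# * φ i j) p ≈⟨ ev-+ _ _ p ⟨
        ev (λ i j → adjoint A φ i j + - 1# * φ i j) p  ∎ }

  record Diagonal (w : Weight) (L : Poly → Poly) : Set (c ⊔ ℓ) where
    constructor diagonal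
    field ev-diagonal : ∀ φ p → ev φ (L p) ≈ ev (λ i j → w i j * φ i j) p

    diagonal-adjoint : Adjoint L
    diagonal-adjoint = record { adjoint = λ φ i j → w i j * φ i j ; ev-adjoint = ev-diagonal }

    w-δ : ∀ i j k l → w k l * δ₂ i j k l ≈ w i j * δ₂ i j k l
    w-δ i j k l with i ℕ.≟ k | j ℕ.≟ l
    ... | yes ≡.refl | yes ≡.refl = refl
    ... | yes _      | no _       = trans (trans (*-congˡ (zeroʳ _)) (zeroʳ _)) (sym (trans (*-congˡ (zeroʳ _)) (zeroʳ _)))
    ... | no _       | _          = trans (trans (*-congˡ (zeroˡ _)) (zeroʳ _)) (sym (trans (*-congˡ (zeroˡ _)) (zeroʳ _)))

    coeff-diagonal : ∀ p i j → coeff (L p) i j ≈ w i j * coeff p i j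
    coeff-diagonal p i j = begin
      coeff (L p) i j                    ≈⟨ coeff-adjoint diagonal-adjoint p i j ⟩
      ev (λ k l → w k l * δ₂ i j k l) p  ≈⟨ ev-cong (w-δ i j) p ⟩
      ev (λ k l → w i j * δ₂ i j k l) p  ≈⟨ ev-*ˡ _ _ p ⟩
      w i j * ev (δ₂ i j) p              ≈⟨ *-congˡ (coeff-ev p i j) ⟨
      w i j * coeff p i j                ∎

    diagonal-* : (∀ i j k l → w (i ℕ.+ k) (j ℕ.+ l) ≈ w i j * w k l) →
      ∀ p r → L (p *P r) ≋ L p *P L r
    diagonal-* w-+ = *-homo-from diagonal-adjoint λ φ i j k l →
      trans (*-congʳ (trans (w-+ i j k l) (*-comm _ _))) (*-assoc _ _ _)

    diagonal-NonZero : (∀ i j → ¬ w i j ≈ 0#) → ∀ {p} → NonZero p → NonZero (L p)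
    diagonal-NonZero w≉0 {p} = NonZero-≋ λ Lp≋0 → ≈P⇒≋ {p} {0P} λ i j →
      cancel-nonzero (w≉0 i j) (trans (sym (coeff-diagonal p i j)) (≋⇒≈P Lp≋0 i j))

  open Diagonal public using (diagonal-adjoint)

  iterate : (Poly → Poly) → ℕ → Poly → Poly
  iterate f zero    p = p
  iterate f (suc n) p = f (iterate f n p)

  coeff-iterate : ∀ {w L} → Diagonal w L → ∀ n p i j →
    coeff (iterate L n p) i j ≈ pow (w i j) n * coeff p i j
  coeff-iterate         A zero    p i j = sym (*-identityˡ _)
  coeff-iterate {w} {L} A (suc n) p i j = begin
    coeff (L (iterate L n p)) i j           ≈⟨ Diagonal.coeff-diagonal A (iterate L n p) i j ⟩
    w i j * coeff (iterate L n p) i j       ≈⟨ *-congˡ (coeff-iterate A n p i j) ⟩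
    w i j * (pow (w i j) n * coeff p i j)   ≈⟨ *-assoc _ _ _ ⟨
    pow (w i j) (suc n) * coeff p i j       ∎

  rescale : (ℕ → Carrier) → Poly → Poly
  rescale w = map λ { (a , i , j) → (a * w j , i , j) }

  rescale-diagonal : ∀ w → Diagonal (λ _ j → w j) (rescale w)
  rescale-diagonal w = diagonal λ φ → ev-map λ a i j → trans (+-identityʳ _) (*-assoc _ _ _)

  τx-diagonal : ∀ q → Diagonal (λ i _ → pow q i) (τxP q)
  τx-diagonal q = diagonal λ φ → ev-map λ a i j → trans (+-identityʳ _) (*-assoc _ _ _)

  τy-diagonal : ∀ q → Diagonal (λ _ j → pow q j) (τyP q)
  τy-diagonal q = diagonal λ φ → ev-map λ a i j → trans (+-identityʳ _) (*-assoc _ _ _)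

  τy-adjoint : ∀ q → Adjoint (τyP q)
  τy-adjoint q = diagonal-adjoint (τy-diagonal q)

  τx-adjoint : ∀ q → Adjoint (τxP q)
  τx-adjoint q = diagonal-adjoint (τx-diagonal q)

  D-adjoint : Adjoint DxP
  D-adjoint = record
    { adjoint    = λ φ i j → ι i * φ (i ∸ 1) j
    ; ev-adjoint = λ φ → ev-map λ a i j → trans (+-identityʳ _)
        (solve 3 (λ n a x → (n :* a) :* x := a :* (n :* x)) refl (ι i) a (φ (i ∸ 1) j)) }

  -- Σₖ (n choose k) f k, the value on (x+1)^n of the functional x^k ↦ f k.
  shifted : ℕ → (ℕ → Carrier) → Carrier
  shifted zero    f = f 0
  shifted (suc n) f = shifted n f + shifted n (f ∘ suc)

  shifted-cong : ∀ n {f g} → (∀ k → f k ≈ g k) → shifted n f ≈ shifted n g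
  shifted-cong zero    f≈g = f≈g 0
  shifted-cong (suc n) f≈g = +-cong (shifted-cong n f≈g) (shifted-cong n (f≈g ∘ suc))

  shifted-+ : ∀ n f g → shifted n (λ k → f k + g k) ≈ shifted n f + shifted n g
  shifted-+ zero    f g = refl
  shifted-+ (suc n) f g = trans (+-cong (shifted-+ n f g) (shifted-+ n (f ∘ suc) (g ∘ suc)))
    (solve 4 (λ a b u v → (a :+ b) :+ (u :+ v) := (a :+ u) :+ (b :+ v)) refl _ _ _ _)

  shifted-*ˡ : ∀ n a f → shifted n (λ k → a * f k) ≈ a * shifted n f
  shifted-*ˡ zero    a f = refl
  shifted-*ˡ (suc n) a f =
    trans (+-cong (shifted-*ˡ n a f) (shifted-*ˡ n a (f ∘ suc))) (sym (distribˡ a _ _))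

  -- This is (x+1)^m (x+1)^n = (x+1)^(m+n), read on functionals.
  shifted-shifted : ∀ m n f →
    shifted n (λ j → shifted m (λ i → f (i ℕ.+ j))) ≈ shifted (m ℕ.+ n) f
  shifted-shifted zero    n f = refl
  shifted-shifted (suc m) n f =
    trans (shifted-+ n _ _) (+-cong (shifted-shifted m n f) (shifted-shifted m n (f ∘ suc)))

  shifted-0 : ∀ n f → (∀ k → k ≤ n → f k ≈ 0#) → shifted n f ≈ 0#
  shifted-0 zero    f f≈0 = f≈0 0 z≤n
  shifted-0 (suc n) f f≈0 = trans
    (+-cong (shifted-0 n f (λ k k≤n → f≈0 k (ℕ.m≤n⇒m≤1+n k≤n)))
            (shifted-0 n (f ∘ suc) (λ k k≤n → f≈0 (suc k) (s≤s k≤n)))) (+-identityˡ _)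

  shifted-top : ∀ n f → (∀ k → k < n → f k ≈ 0#) → shifted n f ≈ f n
  shifted-top zero    f f≈0 = refl
  shifted-top (suc n) f f≈0 = trans
    (+-cong (shifted-0 n f (λ k k≤n → f≈0 k (s≤s k≤n)))
            (shifted-top n (f ∘ suc) (λ k k<n → f≈0 (suc k) (s≤s k<n)))) (+-identityˡ _)

  -- The two top terms of (x+1)^(n+1) are x^(n+1) and (n+1) x^n, and f is blind to the rest. Hence
  -- Δ_x lowers the degree with the same factor n+1 as D_x.
  shifted-next : ∀ n f → (∀ k → k < n → f k ≈ 0#) →
    shifted (suc n) f ≈ f (suc n) + ι (suc n) * f n
  shifted-next zero    f f≈0 =
    trans (+-comm _ _) (+-congˡ (sym (trans (*-congʳ (+-identityʳ 1#)) (*-identityˡ _))))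
  shifted-next (suc n) f f≈0 = begin
    shifted (suc n) f + shifted (suc n) (f ∘ suc)
      ≈⟨ +-cong (shifted-top (suc n) f f≈0) (shifted-next n (f ∘ suc) (λ k k<n → f≈0 (suc k) (s≤s k<n))) ⟩
    f (suc n) + (f (suc (suc n)) + ι (suc n) * f (suc n))
      ≈⟨ trans (+-congʳ (sym (*-identityˡ _)))
           (solve 4 (λ e x y n → e :* x :+ (y :+ n :* x) := y :+ (e :+ n) :* x) refl 1# _ _ _) ⟩
    f (suc (suc n)) + ι (suc (suc n)) * f (suc n) ∎

  private
    -- Summation from the bottom, in the order in which `upTo` lists the exponents; `sumK` runs from
    -- the top.
    sum↑ : ℕ → (ℕ → Carrier) → Carrier
    sum↑ zero    f = 0#
    sum↑ (suc n) f = f 0 + sum↑ n (f ∘ suc)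

    sum↑-cong : ∀ n {f g} → (∀ k → f k ≈ g k) → sum↑ n f ≈ sum↑ n g
    sum↑-cong zero    f≈g = refl
    sum↑-cong (suc n) f≈g = +-cong (f≈g 0) (sum↑-cong n (f≈g ∘ suc))

    sum↑-+ : ∀ n f g → sum↑ n (λ k → f k + g k) ≈ sum↑ n f + sum↑ n g
    sum↑-+ zero    f g = sym (+-identityˡ _)
    sum↑-+ (suc n) f g = trans (+-congˡ (sum↑-+ n (f ∘ suc) (g ∘ suc)))
      (solve 4 (λ a b u v → (a :+ b) :+ (u :+ v) := (a :+ u) :+ (b :+ v)) refl _ _ _ _)

    sum↑-last : ∀ n f → sum↑ (suc n) f ≈ sum↑ n f + f n
    sum↑-last zero    f = +-comm _ _
    sum↑-last (suc n) f = trans (+-congˡ (sum↑-last n (f ∘ suc))) (sym (+-assoc _ _ _))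

    nC0≡1 : ∀ n → n C 0 ≡ 1
    nC0≡1 n = ≡.trans (nCk≡nC[n∸k] {0} {n} z≤n) (nCn≡1 n)

    binomial-sum : ∀ n f → sum↑ (suc n) (λ k → ι (n C k) * f k) ≈ shifted n f
    binomial-sum zero    f = trans (+-identityʳ _) (trans (*-congʳ (+-identityʳ 1#)) (*-identityˡ _))
    binomial-sum (suc n) f = begin
      ι (suc n C 0) * f 0 + sum↑ (suc n) (λ k → ι (suc n C suc k) * f (suc k))
        ≈⟨ +-cong (*-congʳ (reflexive (≡.cong ι (≡.trans (nC0≡1 (suc n)) (≡.sym (nC0≡1 n))))))
             (trans (sum↑-cong (suc n) pascal) (sum↑-+ (suc n) (λ k → ι (n C k) * f (suc k)) (λ k → ι (n C suc k) * f (suc k)))) ⟩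
      ι (n C 0) * f 0 + (sum↑ (suc n) (λ k → ι (n C k) * f (suc k)) + sum↑ (suc n) (λ k → ι (n C suc k) * f (suc k)))
        ≈⟨ solve 3 (λ x y z → x :+ (y :+ z) := (x :+ z) :+ y) refl _ _ _ ⟩
      sum↑ (suc (suc n)) (λ k → ι (n C k) * f k) + sum↑ (suc n) (λ k → ι (n C k) * f (suc k))
        -- The last summand of the longer sum carries n choose n+1, which is 0.
        ≈⟨ +-cong (trans (sum↑-last (suc n) (λ k → ι (n C k) * f k)) (trans (+-cong (binomial-sum n f)
             (trans (*-congʳ (reflexive (≡.cong ι (k>n⇒nCk≡0 (ℕ.n<1+n n))))) (zeroˡ _))) (+-identityʳ _)))
             (binomial-sum n (f ∘ suc)) ⟩
      shifted n f + shifted n (f ∘ suc) ∎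
      where
      pascal : ∀ k → ι (suc n C suc k) * f (suc k) ≈ ι (n C k) * f (suc k) + ι (n C suc k) * f (suc k)
      pascal k = trans (*-congʳ (trans (reflexive (≡.cong ι (≡.sym (nCk+nC[k+1]≡[n+1]C[k+1] n k))))
        (ι-+ (n C k) (n C suc k)))) (distribʳ _ _ _)

    ev-row : ∀ φ a (b : ℕ → Carrier) j (g : ℕ → ℕ) n →
      ev φ (map (λ k → (a * b k , k , j)) (applyUpTo g n)) ≈ a * sum↑ n (λ k → b (g k) * φ (g k) j)
    ev-row φ a b j g zero    = sym (zeroʳ a)
    ev-row φ a b j g (suc n) = trans (+-congˡ (ev-row φ a b j (g ∘ suc) n))
      (solve 4 (λ a x y z → (a :* x) :* y :+ a :* z := a :* (x :* y :+ z)) refl _ _ _ _)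

  σ-adjoint : Adjoint σxP
  σ-adjoint = record
    { adjoint    = λ φ i j → shifted i (λ k → φ k j)
    ; ev-adjoint = λ φ → ev-concatMap λ a i j →
        trans (ev-row φ a (λ k → ι (i C k)) j id (suc i)) (*-congˡ (binomial-sum i _)) }

  -- The substitution x ↦ y^n.
  kronecker : ℕ → Poly → Poly
  kronecker n = map λ { (a , i , j) → (a , 0 , i ℕ.* n ℕ.+ j) }

  kronecker-adjoint : ∀ n → Adjoint (kronecker n)
  kronecker-adjoint n = record
    { adjoint    = λ φ i j → φ 0 (i ℕ.* n ℕ.+ j)
    ; ev-adjoint = λ φ → ev-map λ a i j → +-identityʳ _ }

-- Twisted derivations and the three instances.

module TwistedDerivations {c ℓ} (F : Field c ℓ) where
  open Over F
  open Pairing F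
  open Operators F
  open Adjoint
  open ConcreteOperators F
  open IntegerSolver commutativeRing
  open SetoidReasoning setoid

  τx-* : ∀ q p r → τxP q (p *P r) ≋ τxP q p *P τxP q r
  τx-* q = Diagonal.diagonal-* (τx-diagonal q) λ i j k l → pow-+ q i k

  τy-* : ∀ q p r → τyP q (p *P r) ≋ τyP q p *P τyP q r
  τy-* q = Diagonal.diagonal-* (τy-diagonal q) λ i j k l → pow-+ q j l

  τx-NonZero : ∀ {q} → ¬ q ≈ 0# → ∀ {p} → NonZero p → NonZero (τxP q p)
  τx-NonZero {q} q≉0 = Diagonal.diagonal-NonZero (τx-diagonal q) λ i j → pow-≉0 q≉0 i

  τy-NonZero : ∀ {q} → ¬ q ≈ 0# → ∀ {p} → NonZero p → NonZero (τyP q p)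
  τy-NonZero {q} q≉0 = Diagonal.diagonal-NonZero (τy-diagonal q) λ i j → pow-≉0 q≉0 j

  σ-* : ∀ p r → σxP (p *P r) ≋ σxP p *P σxP r
  σ-* = *-homo-from σ-adjoint λ φ i j k l → sym (shifted-shifted i k (λ s → φ s (j ℕ.+ l)))

  -- (x+1)^i is monic of degree i, so the shift is triangular with diagonal 1.
  σ-NonZero : ∀ {p} → NonZero p → NonZero (σxP p)
  σ-NonZero = NonZero-triangular σ-adjoint (λ _ → 1#) (λ _ → 1≉0)
    (λ i j k l k<i → shifted-0 k (λ s → δ₂ i j s l) λ s s≤k →
      trans (*-congʳ (δ-≢ (ℕ.>⇒≢ (ℕ.≤-<-trans s≤k k<i)))) (zeroˡ _))
    (λ i j l → trans (shifted-top i (λ s → δ₂ i j s l) (λ s s<i →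
      trans (*-congʳ (δ-≢ (ℕ.>⇒≢ s<i))) (zeroˡ _))) (sym (*-identityˡ _)))

  kronecker-* : ∀ n p r → kronecker n (p *P r) ≋ kronecker n p *P kronecker n r
  kronecker-* n = *-homo-from (kronecker-adjoint n) λ φ i j k l → reflexive (≡.cong (φ 0) (digits i j k l))
    where
    open +-*-Solver using () renaming (solve to solveℕ; _:+_ to _:+ℕ_; _:*_ to _:*ℕ_; _:=_ to _:=ℕ_)
    digits : ∀ i j k l → (i ℕ.+ k) ℕ.* n ℕ.+ (j ℕ.+ l) ≡ i ℕ.* n ℕ.+ j ℕ.+ (k ℕ.* n ℕ.+ l)
    digits i j k l = solveℕ 5 (λ i j k l n →
      (i :+ℕ k) :*ℕ n :+ℕ (j :+ℕ l) :=ℕ i :*ℕ n :+ℕ j :+ℕ (k :*ℕ n :+ℕ l)) ≡.refl i j k l n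

  D-* : ∀ p r → DxP (p *P r) ≋ (DxP p *P r) +P (p *P DxP r)
  D-* p r = by-ev λ φ → begin
    ev φ (DxP (p *P r))
      ≈⟨ trans (ev-adjoint D-adjoint φ (p *P r)) (ev-*P _ p r) ⟩
    ev (λ i j → ev (λ k l → ι (i ℕ.+ k) * φ (i ℕ.+ k ∸ 1) (j ℕ.+ l)) r) p
      ≈⟨ ev-cong (λ i j → trans (ev-cong (λ k l → leibniz φ i k (j ℕ.+ l)) r) (ev-+ _ _ r)) p ⟩
    ev (λ i j → ev (λ k l → ι i * φ (i ∸ 1 ℕ.+ k) (j ℕ.+ l)) r + ev (λ k l → ι k * φ (i ℕ.+ (k ∸ 1)) (j ℕ.+ l)) r) p
      ≈⟨ ev-+ _ _ p ⟩
    ev (λ i j → ev (λ k l → ι i * φ (i ∸ 1 ℕ.+ k) (j ℕ.+ l)) r) p + ev (λ i j → ev (λ k l → ι k * φ (i ℕ.+ (k ∸ 1)) (j ℕ.+ l)) r) p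
      ≈⟨ +-cong (trans (ev-cong (λ i j → ev-*ˡ (ι i) _ r) p)
           (sym (trans (ev-*P φ (DxP p) r) (ev-adjoint D-adjoint _ p))))
           (sym (trans (ev-*P φ p (DxP r)) (ev-cong (λ i j → ev-adjoint D-adjoint _ r) p))) ⟩
    ev φ (DxP p *P r) + ev φ (p *P DxP r)
      ≈⟨ ev-++ φ (DxP p *P r) (p *P DxP r) ⟨
    ev φ ((DxP p *P r) +P (p *P DxP r)) ∎
    where
    -- The truncation of i ∸ 1 at i = 0 is harmless, since the factor ι 0 is zero; hence the cases.
    leibniz : ∀ (φ : Weight) i k j →
      ι (i ℕ.+ k) * φ (i ℕ.+ k ∸ 1) j ≈ ι i * φ (i ∸ 1 ℕ.+ k) j + ι k * φ (i ℕ.+ (k ∸ 1)) j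
    leibniz φ zero    k       j = sym (trans (+-congʳ (zeroˡ _)) (+-identityˡ _))
    leibniz φ (suc i) zero    j = begin
      ι (suc i ℕ.+ 0) * φ (i ℕ.+ 0) j ≈⟨ *-congʳ (reflexive (≡.cong ι (ℕ.+-identityʳ (suc i)))) ⟩
      ι (suc i) * φ (i ℕ.+ 0) j       ≈⟨ trans (+-congˡ (zeroˡ _)) (+-identityʳ _) ⟨
      ι (suc i) * φ (i ℕ.+ 0) j + 0# * φ (suc i ℕ.+ 0) j ∎
    leibniz φ (suc i) (suc k) j = begin
      ι (suc i ℕ.+ suc k) * φ (i ℕ.+ suc k) j
        ≈⟨ trans (*-congʳ (ι-+ (suc i) (suc k))) (distribʳ _ _ _) ⟩
      ι (suc i) * φ (i ℕ.+ suc k) j + ι (suc k) * φ (i ℕ.+ suc k) j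
        ≈⟨ +-congˡ (*-congˡ (reflexive (≡.cong (λ n → φ n j) (ℕ.+-suc i k)))) ⟩
      ι (suc i) * φ (i ℕ.+ suc k) j + ι (suc k) * φ (suc i ℕ.+ k) j ∎

  -- `step` unifies the operators through θ = id + step · ∂: it is 1 for the differences and 0 for
  -- D_x, where θ = id.
  record TwistedDerivation (q : Carrier) : Set (c ⊔ ℓ) where
    field
      θ ∂       : Poly → Poly
      θ-adjoint : Adjoint θ
      ∂-adjoint : Adjoint ∂
      θ-*       : ∀ p r → θ (p *P r) ≋ θ p *P θ r
      θ-NonZero : ∀ {p} → NonZero p → NonZero (θ p)
      ∂-*       : ∀ p r → ∂ (p *P r) ≋ (∂ p *P r) +P (θ p *P ∂ r)
      θ-τy      : ∀ p → τyP q (θ p) ≋ θ (τyP q p)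
      ∂-τy      : ∀ p → τyP q (∂ p) ≋ ∂ (τyP q p)
      step      : Poly
      θ-step    : ∀ p → θ p ≋ p +P (step *P ∂ p)

    -- The numerator of ∂(p/r) over the denominator θr · r. For a difference operator it equals θp ·
    -- r - p · θr.
    wronskian : Poly → Poly → Poly
    wronskian p r = (∂ p *P r) +P (-P (p *P ∂ r))

  difference : ∀ {q θ} (A : Adjoint θ) → (∀ p r → θ (p *P r) ≋ θ p *P θ r) →
    (∀ {p} → NonZero p → NonZero (θ p)) → (∀ p → τyP q (θ p) ≋ θ (τyP q p)) →
    TwistedDerivation q
  difference {q} {θ} A θ-* θ-NonZero θ-τy = record
    { θ = θ ; ∂ = λ p → θ p +P (-P p)
    ; θ-adjoint = A ; ∂-adjoint = difference-adjoint A
    ; θ-* = θ-* ; θ-NonZero = θ-NonZero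
    ; ∂-* = λ p r → ≋-trans (P.+-congʳ (θ-* p r))
        (PSolver.solve 4 (λ p θp r θr → θp :*P θr :+P :-P (p :*P r) :=P (θp :+P :-P p) :*P r :+P θp :*P (θr :+P :-P r))
          ≋-refl p (θ p) r (θ r))
    ; θ-τy = θ-τy
    ; ∂-τy = λ p → ≋-trans (+-homo (τy-adjoint q) (θ p) (-P p)) (P.+-cong (θ-τy p) (-‿homo (τy-adjoint q) p))
    ; step = 1P
    ; θ-step = λ p → ≋-sym (≋-trans (P.+-congˡ {p} (P.*-identityˡ (θ p +P (-P p))))
        (PSolver.solve 2 (λ p θp → p :+P (θp :+P :-P p) :=P θp) ≋-refl p (θ p))) }
    where open PSolver using () renaming (_:*_ to _:*P_; _:+_ to _:+P_; :-_ to :-P_; _:=_ to _:=P_)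

  τx-τy : ∀ q p → τyP q (τxP q p) ≋ τxP q (τyP q p)
  τx-τy q = commute (τy-adjoint q) (τx-adjoint q) λ φ i j →
    solve 3 (λ x y z → x :* (y :* z) := y :* (x :* z)) refl _ _ _

  q-difference : ∀ q → ¬ q ≈ 0# → TwistedDerivation q
  q-difference q q≉0 = difference (τx-adjoint q) (τx-* q) (τx-NonZero q≉0) (τx-τy q)

  shift-difference : ∀ q → TwistedDerivation q
  shift-difference q = difference σ-adjoint σ-* σ-NonZero
    (commute (τy-adjoint q) σ-adjoint λ φ i j → shifted-*ˡ i (pow q j) (λ k → φ k j))

  derivation : ∀ q → TwistedDerivation q
  derivation q = record
    { θ = id ; ∂ = DxP ; θ-adjoint = id-adjoint ; ∂-adjoint = D-adjoint
    ; θ-* = λ _ _ → ≋-refl ; θ-NonZero = id ; ∂-* = D-*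
    ; θ-τy = λ _ → ≋-refl
    ; ∂-τy = commute (τy-adjoint q) D-adjoint λ φ i j →
        solve 3 (λ x y z → x :* (y :* z) := y :* (x :* z)) refl _ _ _
    ; step = 0P
    ; θ-step = λ p → by-ev λ φ → sym (trans (ev-++ φ p _) (+-identityʳ _)) }

-- Invariants, coboundaries and norms at a root of unity.

module RootOfUnity {c ℓ} (F : Field c ℓ) (q : Field.Carrier F) (m : ℕ) (order : Over.MinimalOrder F q m) where
  open Over F
  open Pairing F
  open Operators F
  open Adjoint
  open ConcreteOperators F
  open TwistedDerivations F
  open IntegerSolver commutativeRing

  private
    1≤m = proj₁ order
    qᵐ≈1 = proj₁ (proj₂ order)
    minimal = proj₂ (proj₂ order)

    instance
      m≢0 : ℕ.NonZero m
      m≢0 = ℕ.>-nonZero 1≤m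

  pow-∣ : ∀ {j} → m ∣ j → pow q j ≈ 1#
  pow-∣ (divides k ≡.refl) = trans (pow-* q k m) (trans (pow-cong k qᵐ≈1) (pow-1 k))

  -- Otherwise the remainder of j modulo m would be a positive exponent below m at which the power
  -- of q is 1, against minimality.
  pow-∤ : ∀ {j} → ¬ m ∣ j → ¬ pow q j + - 1# ≈ 0#
  pow-∤ {j} m∤j qʲ-1≈0 = minimal (j % m) (ℕ.n≢0⇒n>0 (λ r≡0 → m∤j (m%n≡0⇒n∣m j m r≡0))) (m%n<n j m)
    (begin
      pow q (j % m)                                 ≈⟨ *-identityʳ _ ⟨
      pow q (j % m) * 1#                            ≈⟨ *-congˡ (pow-∣ (divides (j / m) ≡.refl)) ⟨
      pow q (j % m) * pow q ((j / m) ℕ.* m)         ≈⟨ pow-+ q (j % m) _ ⟨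
      pow q (j % m ℕ.+ (j / m) ℕ.* m)               ≡⟨ ≡.cong (pow q) (m≡m%n+[m/n]*n j m) ⟨
      pow q j                                       ≈⟨ x-y≈0⇒x≈y qʲ-1≈0 ⟩
      1#                                            ∎)
    where open SetoidReasoning setoid

  pow-pow : ∀ j → pow (pow q j) m ≈ 1#
  pow-pow j = trans (sym (pow-* q m j)) (pow-∣ (divides j (ℕ.*-comm m j)))

  module _ {w L} (A : Diagonal w L) where
    open SetoidReasoning setoid
    open Diagonal A

    fixed-coeff : ∀ {p} → L p ≋ p → ∀ i j → (w i j + - 1#) * coeff p i j ≈ 0#
    fixed-coeff {p} Lp≋p i j = begin
      (w i j + - 1#) * coeff p i j             ≈⟨ trans (distribʳ _ _ _) (+-congˡ (-1*x≈-x _)) ⟩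
      w i j * coeff p i j + - coeff p i j      ≈⟨ x≈y⇒x-y≈0 (trans (sym (coeff-diagonal p i j)) (≋⇒≈P Lp≋p i j)) ⟩
      0#                                       ∎

  coeff-τx-fixed : ∀ {p} → τxP q p ≋ p → ∀ i j → ¬ m ∣ i → coeff p i j ≈ 0#
  coeff-τx-fixed τp≋p i j m∤i = cancel-nonzero (pow-∤ m∤i) (fixed-coeff (τx-diagonal q) τp≋p i j)

  coeff-τy-fixed : ∀ {p} → τyP q p ≋ p → ∀ i j → ¬ m ∣ j → coeff p i j ≈ 0#
  coeff-τy-fixed τp≋p i j m∤j = cancel-nonzero (pow-∤ m∤j) (fixed-coeff (τy-diagonal q) τp≋p i j)

  iterate-τx : ∀ p → iterate (τxP q) m p ≋ p
  iterate-τx p = ≈P⇒≋ {_} {p} λ i j → trans (coeff-iterate (τx-diagonal q) m p i j)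
    (trans (*-congʳ (pow-pow i)) (*-identityˡ _))

  iterate-τy : ∀ p → iterate (τyP q) m p ≋ p
  iterate-τy p = ≈P⇒≋ {_} {p} λ i j → trans (coeff-iterate (τy-diagonal q) m p i j)
    (trans (*-congʳ (pow-pow j)) (*-identityˡ _))

  -- On the exponents j divisible by m the coboundary vanishes, on the others
  -- the invariant does.
  invariant-coboundary : ∀ {p r} → τyP q p +P (-P p) ≋ r → τyP q r ≋ r → r ≋ 0P
  invariant-coboundary {p} {r} eq τr≋r = ≈P⇒≋ {r} {0P} λ i j → vanish i j (m ∣? j)
    where
    open SetoidReasoning setoid
    vanish : ∀ i j → Dec (m ∣ j) → coeff r i j ≈ 0#
    vanish i j (no m∤j)  = coeff-τy-fixed τr≋r i j m∤j
    vanish i j (yes m∣j) = begin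
      coeff r i j                             ≈⟨ ≋⇒≈P eq i j ⟨
      coeff (τyP q p +P (-P p)) i j           ≈⟨ coeff-ev (τyP q p +P (-P p)) i j ⟩
      ev (δ₂ i j) (τyP q p +P (-P p))         ≈⟨ trans (ev-++ _ (τyP q p) _) (+-congˡ (ev--P _ p)) ⟩
      ev (δ₂ i j) (τyP q p) + - ev (δ₂ i j) p ≈⟨ +-cong (coeff-ev (τyP q p) i j) (-‿cong (coeff-ev p i j)) ⟨
      coeff (τyP q p) i j + - coeff p i j     ≈⟨ x≈y⇒x-y≈0 (trans (Diagonal.coeff-diagonal (τy-diagonal q) p i j)
                                                   (trans (*-congʳ (pow-∣ m∣j)) (*-identityˡ _))) ⟩
      0#                                      ∎

  record Decomposition (p : Poly) : Set (c ⊔ ℓ) where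
    field
      invariant potential : Poly
      τy-invariant : τyP q invariant ≋ invariant
      decomposed   : p ≋ invariant +P (τyP q potential +P (-P potential))

  -- Exponent by exponent this is the scalar identity 1 = e j + (q^j - 1) w j, with e the projector
  -- onto the multiples of m and w j inverse to q^j - 1 elsewhere.
  decomposition : ∀ p → Decomposition p
  decomposition p = record
    { invariant = rescale e p ; potential = rescale w p
    ; τy-invariant = by-ev λ φ → begin
        ev φ (τyP q (rescale e p))                  ≈⟨ trans (ev-adjoint (τy-adjoint q) φ (rescale e p)) (ev-adjoint (E e) _ p) ⟩
        ev (λ i j → e j * (pow q j * φ i j)) p      ≈⟨ ev-cong (λ i j → trans (sym (*-assoc _ _ _)) (*-congʳ (e-fixed j))) p ⟩
        ev (λ i j → e j * φ i j) p                  ≈⟨ ev-adjoint (E e) φ p ⟨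
        ev φ (rescale e p)                          ∎
    ; decomposed = by-ev λ φ → begin
        ev φ p
          ≈⟨ ev-cong (λ i j → trans (sym (*-identityˡ _)) (trans (*-congʳ (split j))
               (solve 4 (λ e w x f → (e :+ (w :* x :+ :- w)) :* f := e :* f :+ (w :* (x :* f) :+ w :* :- f)) refl _ _ _ _))) p ⟩
        ev (λ i j → e j * φ i j + (w j * (pow q j * φ i j) + w j * - φ i j)) p
          ≈⟨ trans (ev-+ _ _ p) (+-congˡ (ev-+ _ _ p)) ⟩
        ev (λ i j → e j * φ i j) p + (ev (λ i j → w j * (pow q j * φ i j)) p + ev (λ i j → w j * - φ i j) p)
          ≈⟨ +-cong (sym (ev-adjoint (E e) φ p)) (+-cong
               (sym (trans (ev-adjoint (τy-adjoint q) φ (rescale w p)) (ev-adjoint (E w) _ p)))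
               (trans (sym (ev-adjoint (E w) _ p)) (trans (ev-cong (λ i j → sym (-1*x≈-x _)) (rescale w p))
                  (trans (ev-*ˡ (- 1#) φ (rescale w p)) (-1*x≈-x _))))) ⟩
        ev φ (rescale e p) + (ev φ (τyP q (rescale w p)) + - ev φ (rescale w p))
          ≈⟨ trans (ev-++ φ (rescale e p) _) (+-congˡ (trans (ev-++ φ (τyP q (rescale w p)) _) (+-congˡ (ev--P φ (rescale w p))))) ⟨
        ev φ (rescale e p +P (τyP q (rescale w p) +P (-P rescale w p))) ∎ }
    where
    open SetoidReasoning setoid
    E : ∀ w → Adjoint (rescale w)
    E w = diagonal-adjoint (rescale-diagonal w)
    e w : ℕ → Carrier
    e j with m ∣? j
    ... | yes _ = 1#
    ... | no  _ = 0#
    w j with m ∣? j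
    ... | yes _   = 0#
    ... | no  m∤j = proj₁ (inverse _ (pow-∤ m∤j))
    e-fixed : ∀ j → e j * pow q j ≈ e j
    e-fixed j with m ∣? j
    ... | yes m∣j = trans (*-identityˡ _) (pow-∣ m∣j)
    ... | no  _   = zeroˡ _
    split : ∀ j → 1# ≈ e j + (w j * pow q j + - w j)
    split j with m ∣? j
    ... | yes _   = sym (trans (+-congˡ (trans (+-congʳ (zeroˡ _)) (-‿inverseʳ 0#))) (+-identityʳ 1#))
    ... | no  m∤j with inverse _ (pow-∤ m∤j)
    ...   | v , eq = sym (trans (+-identityˡ _) (trans (+-congˡ (sym (-1*x≈-x v)))
              (trans (solve 3 (λ v x y → v :* x :+ y :* v := (x :+ y) :* v) refl v _ _) eq)))

  -- conjugates * p is the product of the f-orbit of p.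
  record Norm (f : Poly → Poly) (p : Poly) : Set (c ⊔ ℓ) where
    field
      conjugates : Poly
      conjugates-NonZero : NonZero p → NonZero conjugates
      norm-fixed : f (conjugates *P p) ≋ conjugates *P p
      conjugates-fixed : ∀ {g} → Adjoint g → (∀ p r → g (p *P r) ≋ g p *P g r) → g 1P ≋ 1P →
        (∀ p → g (f p) ≋ f (g p)) → g p ≋ p → g conjugates ≋ conjugates

  -- f permutes the m factors p, f p, ... cyclically, because its m-th iterate fixes p. Keeping p
  -- apart from its conjugates exhibits it as a factor; `conjugates-fixed` later carries invariance
  -- under τ_{q,y} over to a norm taken for τ_{q,x}.
  norm : ∀ {f} → Adjoint f → (∀ p r → f (p *P r) ≋ f p *P f r) → f 1P ≋ 1P →
    (∀ {p} → NonZero p → NonZero (f p)) → ∀ p → iterate f m p ≋ p → Norm f p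
  norm {f} A f-* f-1 f-NonZero p fᵐp≋p = construct m fᵐp≋p 1≤m
    where
    open SetoidReasoning P.setoid
    product : ℕ → Poly
    product zero    = 1P
    product (suc n) = p *P f (product n)
    product-NonZero : NonZero p → ∀ n → NonZero (product n)
    product-NonZero p≉0 zero    = NonZero-1
    product-NonZero p≉0 (suc n) = NonZero-* p≉0 (f-NonZero (product-NonZero p≉0 n))
    product-last : ∀ n → product (suc n) ≋ product n *P iterate f n p
    product-last zero    = P.trans (P.*-congˡ {p} f-1) (P.*-comm p 1P)
    product-last (suc n) = begin
      p *P f (product (suc n))                    ≈⟨ P.*-congˡ {p} (cong A (product-last n)) ⟩
      p *P f (product n *P iterate f n p)         ≈⟨ P.*-congˡ {p} (f-* (product n) (iterate f n p)) ⟩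
      p *P (f (product n) *P iterate f (suc n) p) ≈⟨ P.*-assoc p (f (product n)) (iterate f (suc n) p) ⟨
      product (suc n) *P iterate f (suc n) p      ∎
    product-fixed : ∀ {g} → Adjoint g → (∀ p r → g (p *P r) ≋ g p *P g r) → g 1P ≋ 1P →
      (∀ p → g (f p) ≋ f (g p)) → g p ≋ p → ∀ n → g (product n) ≋ product n
    product-fixed B g-* g-1 gf gp≋p zero    = g-1
    product-fixed B g-* g-1 gf gp≋p (suc n) = P.trans (g-* p (f (product n)))
      (P.*-cong gp≋p (P.trans (gf (product n)) (cong A (product-fixed B g-* g-1 gf gp≋p n))))
    construct : ∀ n → iterate f n p ≋ p → 1 ≤ n → Norm f p
    -- Here m = n + 1: `product n` has m - 1 factors, and f moves them to the conjugates other than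
    -- p.
    construct (suc n) fⁿp≋p _ = record
      { conjugates = f (product n)
      ; conjugates-NonZero = λ p≉0 → f-NonZero (product-NonZero p≉0 n)
      ; norm-fixed = begin
          f (f (product n) *P p)                     ≈⟨ cong A (P.*-comm (f (product n)) p) ⟩
          f (product (suc n))                        ≈⟨ cong A (product-last n) ⟩
          f (product n *P iterate f n p)             ≈⟨ f-* (product n) (iterate f n p) ⟩
          f (product n) *P iterate f (suc n) p       ≈⟨ P.*-congˡ {f (product n)} fⁿp≋p ⟩
          f (product n) *P p                         ∎
      ; conjugates-fixed = λ B g-* g-1 gf gp≋p →
          P.trans (gf (product n)) (cong A (product-fixed B g-* g-1 gf gp≋p n)) }

-- Numerators of derivatives of fractions.

module Wronskian {c ℓ} (F : Field c ℓ) (q : Field.Carrier F) (T : TwistedDerivations.TwistedDerivation F q) where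
  open Over F
  open Pairing F
  open Operators F
  open Adjoint
  open ConcreteOperators F
  open TwistedDerivations F
  open TwistedDerivation T
  open PSolver
  open SetoidReasoning P.setoid

  wronskian-cong : ∀ {p p' r r'} → p ≋ p' → r ≋ r' → wronskian p r ≋ wronskian p' r'
  wronskian-cong p≋ r≋ =
    P.+-cong (P.*-cong (cong ∂-adjoint p≋) r≋) (P.-‿cong (P.*-cong p≋ (cong ∂-adjoint r≋)))

  -- Expanding p/r by s multiplies the denominator θr · r by s · θs, and the numerator gains the
  -- same factor; the terms with ∂s cancel.
  wronskian-scale : ∀ s p r → wronskian (s *P p) (s *P r) ≋ (s *P θ s) *P wronskian p r
  wronskian-scale s p r = begin
    wronskian (s *P p) (s *P r)
      ≈⟨ P.+-cong (P.*-congʳ {s *P r} (∂-* s p)) (P.-‿cong (P.*-congˡ {s *P p} (∂-* s r))) ⟩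
    (((∂ s *P p) +P (θ s *P ∂ p)) *P (s *P r)) +P (-P ((s *P p) *P ((∂ s *P r) +P (θ s *P ∂ r))))
      ≈⟨ solve 7 (λ s θs ∂s p ∂p r ∂r →
           (∂s :* p :+ θs :* ∂p) :* (s :* r) :+ :- ((s :* p) :* (∂s :* r :+ θs :* ∂r)) :=
           (s :* θs) :* (∂p :* r :+ :- (p :* ∂r))) ≋-refl s (θ s) (∂ s) p (∂ p) r (∂ r) ⟩
    (s *P θ s) *P wronskian p r ∎

  wronskian-+ : ∀ p p' r → wronskian (p +P p') r ≋ wronskian p r +P wronskian p' r
  wronskian-+ p p' r = begin
    wronskian (p +P p') r
      ≈⟨ P.+-congʳ (P.*-congʳ {r} (+-homo ∂-adjoint p p')) ⟩
    ((∂ p +P ∂ p') *P r) +P (-P ((p +P p') *P ∂ r))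
      ≈⟨ solve 6 (λ p ∂p p' ∂p' r ∂r → (∂p :+ ∂p') :* r :+ :- ((p :+ p') :* ∂r) :=
           (∂p :* r :+ :- (p :* ∂r)) :+ (∂p' :* r :+ :- (p' :* ∂r))) ≋-refl p (∂ p) p' (∂ p') r (∂ r) ⟩
    wronskian p r +P wronskian p' r ∎

  wronskian-neg : ∀ p r → wronskian (-P p) r ≋ -P wronskian p r
  wronskian-neg p r = begin
    wronskian (-P p) r
      ≈⟨ P.+-congʳ (P.*-congʳ {r} (-‿homo ∂-adjoint p)) ⟩
    ((-P ∂ p) *P r) +P (-P ((-P p) *P ∂ r))
      ≈⟨ solve 4 (λ p ∂p r ∂r → (:- ∂p) :* r :+ :- ((:- p) :* ∂r) := :- (∂p :* r :+ :- (p :* ∂r)))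
           ≋-refl p (∂ p) r (∂ r) ⟩
    -P wronskian p r ∎

  wronskian-τy : ∀ p r → τyP q (wronskian p r) ≋ wronskian (τyP q p) (τyP q r)
  wronskian-τy p r = begin
    τ ((∂ p *P r) +P (-P (p *P ∂ r)))
      ≈⟨ P.trans (+-homo (τy-adjoint q) (∂ p *P r) (-P (p *P ∂ r))) (P.+-congˡ {τ (∂ p *P r)} (-‿homo (τy-adjoint q) (p *P ∂ r))) ⟩
    τ (∂ p *P r) +P (-P τ (p *P ∂ r))
      ≈⟨ P.+-cong (P.trans (τy-* q (∂ p) r) (P.*-congʳ {τ r} (∂-τy p)))
                  (P.-‿cong (P.trans (τy-* q p (∂ r)) (P.*-congˡ {τ p} (∂-τy r)))) ⟩
    wronskian (τ p) (τ r) ∎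
    where τ = τyP q

-- Construction of h, a and b.

module Construction {c ℓ} (F : Field c ℓ) (q : Field.Carrier F) (q≉0 : ¬ Field._≈_ F q (Field.0# F))
  (m : ℕ) (order : Over.MinimalOrder F q m) (T : TwistedDerivations.TwistedDerivation F q) where
  open Over F
  open Pairing F
  open Operators F
  open Adjoint
  open ConcreteOperators F
  open TwistedDerivations F
  open RootOfUnity F q m order
  open TwistedDerivation T
  open Wronskian F q T
  open PSolver
  open SetoidReasoning P.setoid

  private
    τ = τyP q

  -- Both fractions are brought over the τ-invariant denominator W.
  module Solve (f₁ f₂ g₁ g₂ : Poly) (f₂≉0 : NonZero f₂) (g₂≉0 : NonZero g₂)
    (hyp : wronskian f₁ f₂ *P (τ g₂ *P g₂) ≋ ((τ g₁ *P g₂) +P (-P (g₁ *P τ g₂))) *P (θ f₂ *P f₂)) where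

    private
      τ-1 : τ 1P ≋ 1P
      τ-1 = by-ev λ φ → Over.+-congʳ F (Over.*-congʳ F (Over.*-identityʳ F _))

    open Norm (norm (τy-adjoint q) (τy-* q) τ-1 (τy-NonZero q≉0) (f₂ *P g₂) (iterate-τy (f₂ *P g₂)))

    -- K and L are the cofactors of f₂ and g₂ in W, so that f = K f₁ / W and g = L g₁ / W.
    W K L W² : Poly
    W  = conjugates *P (f₂ *P g₂)
    K  = conjugates *P g₂
    L  = conjugates *P f₂
    W² = W *P W

    W≉0 : NonZero W
    W≉0 = NonZero-* (conjugates-NonZero (NonZero-* f₂≉0 g₂≉0)) (NonZero-* f₂≉0 g₂≉0)

    W²≉0 : NonZero W²
    W²≉0 = NonZero-* W≉0 W≉0

    τW≋W : τ W ≋ W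
    τW≋W = norm-fixed

    τW²≋W² : τ W² ≋ W²
    τW²≋W² = P.trans (τy-* q W W) (P.*-cong τW≋W τW≋W)

    W≋Kf₂ : W ≋ K *P f₂
    W≋Kf₂ = solve 3 (λ k a b → k :* (a :* b) := (k :* b) :* a) ≋-refl conjugates f₂ g₂

    W≋Lg₂ : W ≋ L *P g₂
    W≋Lg₂ = solve 3 (λ k a b → k :* (a :* b) := (k :* a) :* b) ≋-refl conjugates f₂ g₂

    f₃ g₃ : Poly
    f₃ = K *P f₁
    g₃ = L *P g₁

    wronskian-f : wronskian f₃ W ≋ (K *P θ K) *P wronskian f₁ f₂
    wronskian-f = P.trans (wronskian-cong ≋-refl W≋Kf₂) (wronskian-scale K f₁ f₂)

    Δg : Poly
    Δg = τ g₃ +P (-P g₃)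

    coboundary-g : Δg *P W ≋ (τ L *P L) *P ((τ g₁ *P g₂) +P (-P (g₁ *P τ g₂)))
    coboundary-g = begin
      (τ g₃ +P (-P g₃)) *P W
        ≈⟨ solve 3 (λ x y w → (x :+ :- y) :* w := x :* w :+ :- (y :* w)) ≋-refl (τ g₃) g₃ W ⟩
      (τ g₃ *P W) +P (-P (g₃ *P W))
        ≈⟨ P.+-cong (P.*-cong (τy-* q L g₁) W≋Lg₂)
             (P.-‿cong (P.*-congˡ {g₃} (P.trans (P.sym τW≋W) (P.trans (cong (τy-adjoint q) W≋Lg₂) (τy-* q L g₂))))) ⟩
      ((τ L *P τ g₁) *P (L *P g₂)) +P (-P ((L *P g₁) *P (τ L *P τ g₂)))
        ≈⟨ solve 6 (λ e e' a a' b b' → (e' :* a') :* (e :* b) :+ :- ((e :* a) :* (e' :* b')) :=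
             (e' :* e) :* (a' :* b :+ :- (a :* b'))) ≋-refl L (τ L) g₁ (τ g₁) g₂ (τ g₂) ⟩
      (τ L *P L) *P ((τ g₁ *P g₂) +P (-P (g₁ *P τ g₂))) ∎

    -- Without W² this would be the hypothesis for f₃/W and g₃/W. Multiplying the given one by the
    -- cofactors of the denominators yields it only with this surplus factor.
    hyp-W : W² *P wronskian f₃ W ≋ W² *P (Δg *P θ W)
    hyp-W = begin
      (W *P W) *P wronskian f₃ W
        ≈⟨ P.*-cong (P.*-cong (P.trans (P.sym τW≋W) (P.trans (cong (τy-adjoint q) W≋Lg₂) (τy-* q L g₂))) W≋Lg₂) wronskian-f ⟩
      ((τ L *P τ g₂) *P (L *P g₂)) *P ((K *P θ K) *P wronskian f₁ f₂)
        ≈⟨ solve 7 (λ e e' b b' k k' w → ((e' :* b') :* (e :* b)) :* ((k :* k') :* w) :=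
             ((e' :* e) :* (k :* k')) :* (w :* (b' :* b))) ≋-refl L (τ L) g₂ (τ g₂) K (θ K) (wronskian f₁ f₂) ⟩
      ((τ L *P L) *P (K *P θ K)) *P (wronskian f₁ f₂ *P (τ g₂ *P g₂))
        ≈⟨ P.*-congˡ {(τ L *P L) *P (K *P θ K)} hyp ⟩
      ((τ L *P L) *P (K *P θ K)) *P (G *P (θ f₂ *P f₂))
        ≈⟨ solve 6 (λ e k k' g b b' → (e :* (k :* k')) :* (g :* (b' :* b)) := (k :* b) :* ((e :* g) :* (k' :* b')))
             ≋-refl (τ L *P L) K (θ K) G f₂ (θ f₂) ⟩
      (K *P f₂) *P (((τ L *P L) *P G) *P (θ K *P θ f₂))
        ≈⟨ P.*-cong W≋Kf₂ (P.*-cong coboundary-g (P.trans (cong θ-adjoint W≋Kf₂) (θ-* K f₂))) ⟨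
      W *P ((Δg *P W) *P θ W)
        ≈⟨ solve 3 (λ w d t → w :* ((d :* w) :* t) := (w :* w) :* (d :* t)) ≋-refl W Δg (θ W) ⟩
      W² *P (Δg *P θ W) ∎
      where G = (τ g₁ *P g₂) +P (-P (g₁ *P τ g₂))

    open Decomposition (decomposition f₃) public renaming (invariant to A₀; potential to H)

    -- B is the numerator of g - ∂h over θW · W. Y and Z carry the surplus W² of `hyp-W`.
    B Y Z : Poly
    B = (g₃ *P θ W) +P (-P wronskian H W)
    Y = W² *P B
    Z = W² *P wronskian A₀ W

    τθW : τ (θ W) ≋ θ W
    τθW = P.trans (θ-τy W) (cong θ-adjoint τW≋W)

    τ-wronskian : ∀ p → τ (wronskian p W) ≋ wronskian (τ p) W
    τ-wronskian p = P.trans (wronskian-τy p W) (wronskian-cong ≋-refl τW≋W)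

    wronskian-f₃ : wronskian f₃ W ≋ wronskian A₀ W +P (wronskian (τ H) W +P (-P wronskian H W))
    wronskian-f₃ = begin
      wronskian f₃ W ≈⟨ wronskian-cong decomposed ≋-refl ⟩
      wronskian (A₀ +P (τ H +P (-P H))) W ≈⟨ wronskian-+ A₀ (τ H +P (-P H)) W ⟩
      wronskian A₀ W +P wronskian (τ H +P (-P H)) W
        ≈⟨ P.+-congˡ {wronskian A₀ W} (P.trans (wronskian-+ (τ H) (-P H) W) (P.+-congˡ {wronskian (τ H) W} (wronskian-neg H W))) ⟩
      wronskian A₀ W +P (wronskian (τ H) W +P (-P wronskian H W)) ∎

    -- τ sends the numerator of ∂(H/W) to that of ∂(τH/W), so the contributions of H cancel those in
    -- `wronskian-f₃`, and only A₀ is left.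
    coboundary-Y : τ Y +P (-P Y) ≋ Z
    coboundary-Y = begin
      τ Y +P (-P Y)
        ≈⟨ P.+-congʳ (P.trans (τy-* q W² B) (P.*-cong τW²≋W² τB)) ⟩
      (W² *P ((τ g₃ *P θ W) +P (-P wronskian (τ H) W))) +P (-P Y)
        ≈⟨ solve 6 (λ w g' g t h' h → w :* (g' :* t :+ :- h') :+ :- (w :* (g :* t :+ :- h)) :=
             w :* ((g' :+ :- g) :* t) :+ :- (w :* (h' :+ :- h)))
             ≋-refl W² (τ g₃) g₃ (θ W) (wronskian (τ H) W) (wronskian H W) ⟩
      (W² *P (Δg *P θ W)) +P (-P (W² *P hh))
        ≈⟨ P.+-congʳ (P.trans (P.sym hyp-W) (P.*-congˡ {W²} wronskian-f₃)) ⟩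
      (W² *P (wronskian A₀ W +P hh)) +P (-P (W² *P hh))
        ≈⟨ solve 3 (λ w a h → w :* (a :+ h) :+ :- (w :* h) := w :* a) ≋-refl W² (wronskian A₀ W) hh ⟩
      Z ∎
      where
      hh = wronskian (τ H) W +P (-P wronskian H W)
      τB : τ B ≋ (τ g₃ *P θ W) +P (-P wronskian (τ H) W)
      τB = begin
        τ B ≈⟨ P.trans (+-homo (τy-adjoint q) (g₃ *P θ W) (-P wronskian H W))
                 (P.+-congˡ {τ (g₃ *P θ W)} (-‿homo (τy-adjoint q) (wronskian H W))) ⟩
        τ (g₃ *P θ W) +P (-P τ (wronskian H W))
          ≈⟨ P.+-cong (P.trans (τy-* q g₃ (θ W)) (P.*-congˡ {τ g₃} τθW)) (P.-‿cong (τ-wronskian H)) ⟩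
        (τ g₃ *P θ W) +P (-P wronskian (τ H) W) ∎

    Z≋0 : Z ≋ 0P
    Z≋0 = invariant-coboundary {Y} coboundary-Y
      (P.trans (τy-* q W² (wronskian A₀ W))
        (P.*-cong τW²≋W² (P.trans (τ-wronskian A₀) (wronskian-cong τy-invariant ≋-refl))))

    τY≋Y : τ Y ≋ Y
    τY≋Y = begin
      τ Y                     ≈⟨ solve 2 (λ x y → x := (x :+ :- y) :+ y) ≋-refl (τ Y) Y ⟩
      (τ Y +P (-P Y)) +P Y    ≈⟨ P.+-congʳ (P.trans coboundary-Y Z≋0) ⟩
      Y                       ∎

    -- A₀/W expanded by W²: only W² times the numerator of ∂(A₀/W) is known to vanish, and the
    -- numerator of ∂(A/V) contains that product.
    A V : Poly
    A = W² *P A₀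
    V = W² *P W

    V≉0 : NonZero V
    V≉0 = NonZero-* W²≉0 W≉0

    τA≋A : τ A ≋ A
    τA≋A = P.trans (τy-* q W² A₀) (P.*-cong τW²≋W² τy-invariant)

    τV≋V : τ V ≋ V
    τV≋V = P.trans (τy-* q W² W) (P.*-cong τW²≋W² τW≋W)

    wronskian-AV : wronskian A V ≋ 0P
    wronskian-AV = begin
      wronskian A V                       ≈⟨ wronskian-scale W² A₀ W ⟩
      (W² *P θ W²) *P wronskian A₀ W      ≈⟨ solve 3 (λ w t x → (w :* t) :* x := t :* (w :* x)) ≋-refl W² (θ W²) (wronskian A₀ W) ⟩
      θ W² *P Z                           ≈⟨ P.*-congˡ {θ W²} Z≋0 ⟩
      θ W² *P 0P                          ≈⟨ P.zeroʳ (θ W²) ⟩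
      0P                                  ∎

    f-equation : f₁ *P ((τ W *P W) *P V) ≋
      ((((τ H *P W) +P (-P (H *P τ W))) *P V) +P (A *P (τ W *P W))) *P f₂
    f-equation = begin
      f₁ *P ((τ W *P W) *P V)
        ≈⟨ P.*-congˡ {f₁} (P.*-congʳ {V} (P.*-congʳ {W} τW≋W)) ⟩
      f₁ *P ((W *P W) *P V)
        ≈⟨ solve 2 (λ f w → f :* ((w :* w) :* ((w :* w) :* w)) := (w :* w) :* (w :* w) :* (f :* w)) ≋-refl f₁ W ⟩
      (W² *P W²) *P (f₁ *P W)
        ≈⟨ P.*-congˡ {W² *P W²} (P.*-congˡ {f₁} W≋Kf₂) ⟩
      (W² *P W²) *P (f₁ *P (K *P f₂))
        ≈⟨ solve 4 (λ w f k b → w :* (f :* (k :* b)) := (w :* (k :* f)) :* b) ≋-refl (W² *P W²) f₁ K f₂ ⟩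
      ((W² *P W²) *P f₃) *P f₂
        ≈⟨ P.*-congʳ {f₂} (P.*-congˡ {W² *P W²} decomposed) ⟩
      ((W² *P W²) *P (A₀ +P (τ H +P (-P H)))) *P f₂
        ≈⟨ P.*-congʳ {f₂} (solve 4 (λ w a h' h → ((w :* w) :* (w :* w)) :* (a :+ (h' :+ :- h)) :=
             (h' :* w :+ :- (h :* w)) :* ((w :* w) :* w) :+ ((w :* w) :* a) :* (w :* w)) ≋-refl W A₀ (τ H) H) ⟩
      ((((τ H *P W) +P (-P (H *P W))) *P V) +P (A *P (W *P W))) *P f₂
        ≈⟨ P.*-congʳ {f₂} (P.+-cong (P.*-congʳ {V} (P.+-congˡ {τ H *P W} (P.-‿cong (P.*-congˡ {H} τW≋W))))
             (P.*-congˡ {A} (P.*-congʳ {W} τW≋W))) ⟨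
      ((((τ H *P W) +P (-P (H *P τ W))) *P V) +P (A *P (τ W *P W))) *P f₂ ∎

    -- `h₁` stands for the numerator of ∂h in its defining form, which in general agrees with the
    -- wronskian only up to `_≋_`.
    b-equation : ∀ {h₁} → h₁ ≋ wronskian H W →
      ((g₁ *P (θ W *P W)) +P (-P (h₁ *P g₂))) *P (W² *P (θ W *P W)) ≋ Y *P (g₂ *P (θ W *P W))
    b-equation {h₁} h₁≋ = begin
      ((g₁ *P (θ W *P W)) +P (-P (h₁ *P g₂))) *P (W² *P (θ W *P W))
        ≈⟨ P.*-congʳ {W² *P (θ W *P W)} (P.+-cong (P.*-congˡ {g₁} (P.*-congˡ {θ W} W≋Lg₂)) (P.-‿cong (P.*-congʳ {g₂} h₁≋))) ⟩
      ((g₁ *P (θ W *P (L *P g₂))) +P (-P (wronskian H W *P g₂))) *P (W² *P (θ W *P W))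
        ≈⟨ solve 7 (λ g t e b h w v → (g :* (t :* (e :* b)) :+ :- (h :* b)) :* (v :* (t :* w)) :=
             (v :* ((e :* g) :* t :+ :- h)) :* (b :* (t :* w))) ≋-refl g₁ (θ W) L g₂ (wronskian H W) W W² ⟩
      Y *P (g₂ *P (θ W *P W)) ∎

-- Constant fractions and their higher derivatives.

module TwistedConstants {c ℓ} (F : Field c ℓ) (q : Field.Carrier F) (T : TwistedDerivations.TwistedDerivation F q) where
  open Over F
  open Pairing F
  open Operators F
  open Adjoint
  open ConcreteOperators F
  open TwistedDerivations F
  open TwistedDerivation T
  open Wronskian F q T
  open PSolver
  open SetoidReasoning P.setoid

  diff≋0⇒≋ : ∀ {p r} → p +P (-P r) ≋ 0P → p ≋ r
  diff≋0⇒≋ {p} {r} eq = begin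
    p                    ≈⟨ solve 2 (λ p r → p := (p :+ :- r) :+ r) ≋-refl p r ⟩
    (p +P (-P r)) +P r   ≈⟨ P.+-congʳ eq ⟩
    r                    ∎

  ≋⇒diff≋0 : ∀ {p r} → p ≋ r → p +P (-P r) ≋ 0P
  ≋⇒diff≋0 {p} {r} p≋r = P.trans (P.+-congʳ p≋r) (P.-‿inverseʳ r)

  annihilated : ∀ {p r} → r ≋ 0P → p *P r ≋ 0P
  annihilated {p} r≋0 = P.trans (P.*-congˡ {p} r≋0) (P.zeroʳ p)

  -- A constant fraction is fixed by θ = id + step · ∂; this is the cross-multiplied form.
  θ-swap : ∀ {A V} → wronskian A V ≋ 0P → θ A *P V ≋ A *P θ V
  θ-swap {A} {V} W≋0 = diff≋0⇒≋ (begin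
    (θ A *P V) +P (-P (A *P θ V))
      ≈⟨ P.+-cong (P.*-congʳ {V} (θ-step A)) (P.-‿cong (P.*-congˡ {A} (θ-step V))) ⟩
    ((A +P (step *P ∂ A)) *P V) +P (-P (A *P (V +P (step *P ∂ V))))
      ≈⟨ solve 5 (λ a a' v v' s → (a :+ s :* a') :* v :+ :- (a :* (v :+ s :* v')) :=
           s :* (a' :* v :+ :- (a :* v'))) ≋-refl A (∂ A) V (∂ V) step ⟩
    step *P wronskian A V
      ≈⟨ annihilated {step} W≋0 ⟩
    0P ∎)

  ∂ⁿ : ℕ → Poly → Poly
  ∂ⁿ = iterate ∂

  module Torsion (A V : Poly) (V≉0 : NonZero V) (W≋0 : wronskian A V ≋ 0P) where

    -- Zero in the field of fractions, since A/V is a constant; without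
    -- cancellation, Y k is only killed by the nonzero polynomial torsion n.
    Y : ℕ → Poly
    Y n = (∂ⁿ n A *P V) +P (-P (∂ⁿ n V *P A))

    ∂-swap : V *P ∂ A ≋ A *P ∂ V
    ∂-swap = P.trans (P.*-comm V (∂ A)) (diff≋0⇒≋ W≋0)

    -- After the twisted Leibniz rule, the terms outside `Y (suc n)` combine into a multiple of θ (Y
    -- n) by V · ∂A = A · ∂V and θA · V = A · θV; the factor V · θV makes both usable without
    -- division.
    ∂Y : ∀ n → (V *P θ V) *P ∂ (Y n) ≋ ((V *P θ V) *P Y (suc n)) +P ((V *P ∂ V) *P θ (Y n))
    ∂Y n = begin
      (V *P θ V) *P ∂ (Y n)
        ≈⟨ P.*-congˡ {V *P θ V} (P.trans (+-homo ∂-adjoint (a *P V) (-P (v *P A)))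
             (P.+-cong (∂-* a V) (P.trans (-‿homo ∂-adjoint (v *P A)) (P.-‿cong (∂-* v A))))) ⟩
      (V *P θ V) *P (((∂ a *P V) +P (θ a *P ∂ V)) +P (-P ((∂ v *P A) +P (θ v *P ∂ A))))
        ≈⟨ solve 9 (λ a' ta v' tv A A' V V' tV →
             (V :* tV) :* ((a' :* V :+ ta :* V') :+ :- (v' :* A :+ tv :* A')) :=
             (V :* tV) :* (a' :* V :+ :- (v' :* A)) :+ (V :* V' :* (ta :* tV) :+ :- (tv :* tV :* (V :* A'))))
             ≋-refl (∂ a) (θ a) (∂ v) (θ v) A (∂ A) V (∂ V) (θ V) ⟩
      Y' +P (((V *P ∂ V) *P (θ a *P θ V)) +P (-P ((θ v *P θ V) *P (V *P ∂ A))))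
        ≈⟨ P.+-congˡ {Y'} (P.+-congˡ {(V *P ∂ V) *P (θ a *P θ V)} (P.-‿cong swap)) ⟩
      Y' +P (((V *P ∂ V) *P (θ a *P θ V)) +P (-P ((V *P ∂ V) *P (θ v *P θ A))))
        ≈⟨ P.+-congˡ {Y'} (solve 3 (λ s x y → s :* x :+ :- (s :* y) := s :* (x :+ :- y))
             ≋-refl (V *P ∂ V) (θ a *P θ V) (θ v *P θ A)) ⟩
      Y' +P ((V *P ∂ V) *P ((θ a *P θ V) +P (-P (θ v *P θ A))))
        ≈⟨ P.+-congˡ {Y'} (P.*-congˡ {V *P ∂ V} (P.trans (+-homo θ-adjoint (a *P V) (-P (v *P A)))
             (P.+-cong (θ-* a V) (P.trans (-‿homo θ-adjoint (v *P A)) (P.-‿cong (θ-* v A)))))) ⟨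
      Y' +P ((V *P ∂ V) *P θ (Y n)) ∎
      where
      a = ∂ⁿ n A
      v = ∂ⁿ n V
      Y' = (V *P θ V) *P Y (suc n)
      swap : (θ v *P θ V) *P (V *P ∂ A) ≋ (V *P ∂ V) *P (θ v *P θ A)
      swap = begin
        (θ v *P θ V) *P (V *P ∂ A) ≈⟨ P.*-congˡ {θ v *P θ V} ∂-swap ⟩
        (θ v *P θ V) *P (A *P ∂ V) ≈⟨ solve 4 (λ x y a d → (x :* y) :* (a :* d) := (x :* d) :* (a :* y)) ≋-refl (θ v) (θ V) A (∂ V) ⟩
        (θ v *P ∂ V) *P (A *P θ V) ≈⟨ P.*-congˡ {θ v *P ∂ V} (θ-swap W≋0) ⟨
        (θ v *P ∂ V) *P (θ A *P V) ≈⟨ solve 4 (λ x d t v → (x :* d) :* (t :* v) := (v :* d) :* (x :* t)) ≋-refl (θ v) (∂ V) (θ A) V ⟩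
        (V *P ∂ V) *P (θ v *P θ A) ∎

    torsion : ℕ → Poly
    torsion zero    = 1P
    torsion (suc n) = (torsion n *P θ (torsion n)) *P (V *P θ V)

    torsion-NonZero : ∀ n → NonZero (torsion n)
    torsion-NonZero zero    = NonZero-1
    torsion-NonZero (suc n) =
      NonZero-* (NonZero-* (torsion-NonZero n) (θ-NonZero (torsion-NonZero n))) (NonZero-* V≉0 (θ-NonZero V≉0))

    -- Applying ∂ and θ to t · Y n = 0 gives ∂t · Y n + θt · ∂(Y n) = 0 and θt · θ(Y n) = 0.
    -- Multiplied by t, the first becomes t · θt · ∂(Y n) = 0, and `∂Y` converts this into the
    -- claim.
    torsion-next : ∀ t n → t *P Y n ≋ 0P → ((t *P θ t) *P (V *P θ V)) *P Y (suc n) ≋ 0P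
    torsion-next t n tY≋0 = begin
      ((t *P θ t) *P (V *P θ V)) *P Y (suc n)
        ≈⟨ solve 6 (λ t t' w y s z → (t :* t') :* w :* y := (t :* t') :* (w :* y :+ s :* z) :+ :- (t :* s :* (t' :* z)))
             ≋-refl t (θ t) (V *P θ V) (Y (suc n)) (V *P ∂ V) (θ (Y n)) ⟩
      ((t *P θ t) *P (((V *P θ V) *P Y (suc n)) +P ((V *P ∂ V) *P θ (Y n)))) +P (-P ((t *P (V *P ∂ V)) *P (θ t *P θ (Y n))))
        ≈⟨ P.+-cong (P.*-congˡ {t *P θ t} (P.sym (∂Y n)))
             (P.-‿cong (annihilated {t *P (V *P ∂ V)} (P.trans (P.sym (θ-* t (Y n))) (P.trans (cong θ-adjoint tY≋0) (0-homo θ-adjoint))))) ⟩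
      ((t *P θ t) *P ((V *P θ V) *P ∂ (Y n))) +P (-P 0P)
        ≈⟨ P.+-identityʳ ((t *P θ t) *P ((V *P θ V) *P ∂ (Y n))) ⟩
      (t *P θ t) *P ((V *P θ V) *P ∂ (Y n))
        ≈⟨ solve 6 (λ t t' w y' d y → (t :* t') :* (w :* y') := w :* t :* (d :* y :+ t' :* y') :+ :- (w :* d :* (t :* y)))
             ≋-refl t (θ t) (V *P θ V) (∂ (Y n)) (∂ t) (Y n) ⟩
      (((V *P θ V) *P t) *P ((∂ t *P Y n) +P (θ t *P ∂ (Y n)))) +P (-P (((V *P θ V) *P ∂ t) *P (t *P Y n)))
        ≈⟨ P.+-cong (annihilated {(V *P θ V) *P t} (P.trans (P.sym (∂-* t (Y n))) (P.trans (cong ∂-adjoint tY≋0) (0-homo ∂-adjoint))))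
             (P.-‿cong (annihilated {(V *P θ V) *P ∂ t} tY≋0)) ⟩
      0P +P (-P 0P)
        ≈⟨ P.-‿inverseʳ 0P ⟩
      0P ∎

    -- Each torsion polynomial is a multiple of the preceding one, so a single one serves all k up
    -- to n.
    torsion-kills : ∀ n k → k ≤ n → torsion n *P Y k ≋ 0P
    torsion-kills zero    zero    _   = annihilated {1P} (≋⇒diff≋0 (P.*-comm A V))
    torsion-kills (suc n) k       k≤1+n with k ℕ.≟ suc n
    ... | yes ≡.refl = torsion-next (torsion n) n (torsion-kills n n ℕ.≤-refl)
    ... | no  k≢1+n  = P.trans
      (solve 4 (λ t t' w y → (t :* t') :* w :* y := (t' :* w) :* (t :* y))
        ≋-refl (torsion n) (θ (torsion n)) (V *P θ V) (Y k))
      (annihilated {θ (torsion n) *P (V *P θ V)} (torsion-kills n k (ℕ.≤-pred (ℕ.≤∧≢⇒< k≤1+n k≢1+n))))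

    -- Expanding A/V by the torsion must not destroy the invariance of numerator and denominator.
    torsion-fixed : τyP q V ≋ V → ∀ n → τyP q (torsion n) ≋ torsion n
    torsion-fixed τV≋V zero    = by-ev λ φ → +-congʳ (*-congʳ (*-identityʳ _))
    torsion-fixed τV≋V (suc n) = P.trans (τy-* q (torsion n *P θ (torsion n)) (V *P θ V)) (P.*-cong
      (P.trans (τy-* q (torsion n) (θ (torsion n))) (P.*-cong ih (θ-fixed ih)))
      (P.trans (τy-* q V (θ V)) (P.*-cong τV≋V (θ-fixed τV≋V))))
      where
      ih = torsion-fixed τV≋V n
      θ-fixed : ∀ {p} → τyP q p ≋ p → τyP q (θ p) ≋ θ p
      θ-fixed {p} τp≋p = P.trans (θ-τy p) (cong θ-adjoint τp≋p)

-- Injectivity of the substitution x = y^n, and degrees in x.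

module Kronecker {c ℓ} (F : Field c ℓ) where
  open Over F
  open Pairing F
  open Operators F
  open Adjoint
  open ConcreteOperators F
  open TwistedDerivations F
  open SetoidReasoning setoid

  kronecker-kronecker : ∀ n p → kronecker n (kronecker n p) ≋ kronecker n p
  kronecker-kronecker n p = by-ev λ φ → trans (ev-adjoint (kronecker-adjoint n) φ (kronecker n p))
    (trans (ev-adjoint (kronecker-adjoint n) _ p) (sym (ev-adjoint (kronecker-adjoint n) φ p)))

  coeff-kronecker-suc : ∀ n p i j → coeff (kronecker n p) (suc i) j ≈ 0#
  coeff-kronecker-suc n p i j = trans (coeff-adjoint (kronecker-adjoint n) p (suc i) j)
    (ev-0 (λ k l → trans (*-congʳ (δ-≢ {suc i} {0} λ ())) (zeroˡ _)) p)

  digits-unique : ∀ n .{{_ : ℕ.NonZero n}} i j k l → j < n → l < n →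
    i ℕ.* n ℕ.+ j ≡ k ℕ.* n ℕ.+ l → i ≡ k × j ≡ l
  digits-unique n i j k l j<n l<n eq = i≡k , j≡l
    where
    digit : ∀ i j → j < n → (i ℕ.* n ℕ.+ j) % n ≡ j
    digit i j j<n = ≡.trans (≡.cong (_% n) (ℕ.+-comm (i ℕ.* n) j))
      (≡.trans ([m+kn]%n≡m%n j i n) (m<n⇒m%n≡m j<n))
    j≡l : j ≡ l
    j≡l = ≡.trans (≡.sym (digit i j j<n)) (≡.trans (≡.cong (_% n) eq) (digit k l l<n))
    i≡k : i ≡ k
    i≡k = ℕ.*-cancelʳ-≡ i k n (ℕ.+-cancelʳ-≡ j (i ℕ.* n) (k ℕ.* n)
      (≡.trans eq (≡.cong (k ℕ.* n ℕ.+_) (≡.sym j≡l))))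

  -- For j below n the pair (i, j) is recovered as quotient and remainder, so distinct monomials are
  -- not merged; those with y-exponent at least n have coefficient zero.
  coeff-kronecker : ∀ n .{{_ : ℕ.NonZero n}} p → bound p ≤ n → ∀ i j → j < n →
    coeff (kronecker n p) 0 (i ℕ.* n ℕ.+ j) ≈ coeff p i j
  coeff-kronecker n p b≤n i j j<n = begin
    coeff (kronecker n p) 0 (i ℕ.* n ℕ.+ j)                      ≈⟨ coeff-adjoint (kronecker-adjoint n) p 0 _ ⟩
    ev (λ k l → δ₂ 0 (i ℕ.* n ℕ.+ j) 0 (k ℕ.* n ℕ.+ l)) p        ≈⟨ ev-agree _ _ p agree ⟩
    ev (δ₂ i j) p                                                ≈⟨ coeff-ev p i j ⟨
    coeff p i j                                                  ∎
    where
    compare : ∀ k l → l < n → δ₂ 0 (i ℕ.* n ℕ.+ j) 0 (k ℕ.* n ℕ.+ l) ≈ δ₂ i j k l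
    compare k l l<n = trans (*-identityˡ _) (case (i ℕ.≟ k) (j ℕ.≟ l))
      where
      case : Dec (i ≡ k) → Dec (j ≡ l) → δ (i ℕ.* n ℕ.+ j) (k ℕ.* n ℕ.+ l) ≈ δ i k * δ j l
      case (yes ≡.refl) (yes ≡.refl) = trans (δ-refl (i ℕ.* n ℕ.+ j)) (sym (trans (*-cong (δ-refl i) (δ-refl j)) (*-identityˡ _)))
      case (no i≢k)     _            = trans (δ-≢ (λ eq → i≢k (proj₁ (digits-unique n i j k l j<n l<n eq))))
        (sym (trans (*-congʳ (δ-≢ i≢k)) (zeroˡ _)))
      case (yes _)      (no j≢l)     = trans (δ-≢ (λ eq → j≢l (proj₂ (digits-unique n i j k l j<n l<n eq))))
        (sym (trans (*-congˡ (δ-≢ j≢l)) (zeroʳ _)))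
    agree : ∀ k l → coeff p k l ≈ 0# ⊎ δ₂ 0 (i ℕ.* n ℕ.+ j) 0 (k ℕ.* n ℕ.+ l) ≈ δ₂ i j k l
    agree k l with l ℕ.<? n
    ... | yes l<n = inj₂ (compare k l l<n)
    ... | no  l≮n = inj₁ (coeff-bound p k l (inj₂ (ℕ.≤-trans b≤n (ℕ.≮⇒≥ l≮n))))

  kronecker-NonZero : ∀ n .{{_ : ℕ.NonZero n}} {p} → bound p ≤ n → NonZero p → NonZero (kronecker n p)
  kronecker-NonZero n {p} b≤n = NonZero-≋ λ κp≋0 → ≈P⇒≋ {p} {0P} λ i j → vanish κp≋0 i j
    where
    vanish : kronecker n p ≋ 0P → ∀ i j → coeff p i j ≈ 0#
    vanish κp≋0 i j with j ℕ.<? n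
    ... | yes j<n = trans (sym (coeff-kronecker n p b≤n i j j<n)) (≋⇒≈P κp≋0 0 _)
    ... | no  j≮n = coeff-bound p i j (inj₂ (ℕ.≤-trans b≤n (ℕ.≮⇒≥ j≮n)))

  XDegree< : ℕ → Poly → Set ℓ
  XDegree< n p = ∀ i j → n ≤ i → coeff p i j ≈ 0#

  xdegree-bound : ∀ {n} p → bound p ≤ n → XDegree< n p
  xdegree-bound p b≤n i j n≤i = coeff-bound p i j (inj₁ (ℕ.≤-trans b≤n n≤i))

  xdegree-difference : ∀ {n p r} → XDegree< n p → XDegree< n r → XDegree< n (p +P (-P r))
  xdegree-difference {n} {p} {r} p< r< i j n≤i = begin
    coeff (p +P (-P r)) i j           ≈⟨ coeff-ev (p +P (-P r)) i j ⟩
    ev (δ₂ i j) (p +P (-P r))         ≈⟨ trans (ev-++ _ p (-P r)) (+-congˡ (ev--P _ r)) ⟩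
    ev (δ₂ i j) p + - ev (δ₂ i j) r   ≈⟨ x≈y⇒x-y≈0 (trans (trans (sym (coeff-ev p i j)) (p< i j n≤i))
                                           (sym (trans (sym (coeff-ev r i j)) (r< i j n≤i)))) ⟩
    0#                                ∎

  xdegree-kronecker-* : ∀ {n p} k r → XDegree< n p → XDegree< n (kronecker k r *P p)
  xdegree-kronecker-* {n} {p} k r p< i j n≤i = begin
    coeff (kronecker k r *P p) i j
      ≈⟨ trans (coeff-ev (kronecker k r *P p) i j) (trans (ev-*P _ (kronecker k r) p) (ev-adjoint (kronecker-adjoint k) _ r)) ⟩
    ev (λ a b → ev (λ u v → δ₂ i j u (a ℕ.* k ℕ.+ b ℕ.+ v)) p) r
      ≈⟨ ev-0 (λ a b → ev-vanish _ p λ u v → small a b u v) r ⟩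
    0# ∎
    where
    small : ∀ a b u v → coeff p u v ≈ 0# ⊎ δ₂ i j u (a ℕ.* k ℕ.+ b ℕ.+ v) ≈ 0#
    small a b u v with n ℕ.≤? u
    ... | yes n≤u = inj₁ (p< u v n≤u)
    ... | no  n≰u = inj₂ (trans (*-congʳ (δ-≢ {i} {u} (λ { ≡.refl → n≰u n≤i }))) (zeroˡ _))

-- D_x and Δ_x lower the degree in x.

module Lowering {c ℓ} (F : Field c ℓ) (q : Field.Carrier F) where
  open Over F
  open Pairing F
  open Operators F
  open Adjoint
  open ConcreteOperators F
  open TwistedDerivations F
  open SetoidReasoning setoid

  -- ∂ x^(i+1) = (i+1) x^i + terms of lower degree.
  record LowersDegree (T : TwistedDerivation q) : Set (c ⊔ ℓ) where
    open TwistedDerivation T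
    field
      below   : ∀ i j k l → k < suc i → adjoint ∂-adjoint (δ₂ i j) k l ≈ 0#
      leading : ∀ i j l → adjoint ∂-adjoint (δ₂ i j) (suc i) l ≈ ι (suc i) * δ₂ (suc i) j (suc i) l

  private
    δ₂-suc : ∀ i j l → δ₂ i j i l ≈ δ₂ (suc i) j (suc i) l
    δ₂-suc i j l = *-congʳ (trans (δ-refl i) (sym (δ-refl (suc i))))

    δ₂-> : ∀ {i k} j l → k < i → δ₂ i j k l ≈ 0#
    δ₂-> j l k<i = trans (*-congʳ (δ-≢ (ℕ.>⇒≢ k<i))) (zeroˡ (δ j l))

  derivation-lowers : LowersDegree (derivation q)
  derivation-lowers = record
    { below   = below
    ; leading = λ i j l → *-congˡ (δ₂-suc i j l) }
    where
    below : ∀ i j k l → k < suc i → ι k * δ₂ i j (k ∸ 1) l ≈ 0#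
    below i j zero    l _         = zeroˡ _
    below i j (suc k) l (s≤s k<i) = trans (*-congˡ (δ₂-> j l k<i)) (zeroʳ _)

  shift-difference-lowers : LowersDegree (shift-difference q)
  shift-difference-lowers = record
    { below   = λ i j k l k<1+i → trans
        (+-cong (shifted-top k (λ s → δ₂ i j s l) (λ s s<k → δ₂-> j l (ℕ.<-≤-trans s<k (ℕ.≤-pred k<1+i)))) (-1*x≈-x _))
        (-‿inverseʳ _)
    ; leading = λ i j l → begin
        shifted (suc i) (λ s → δ₂ i j s l) + - 1# * δ₂ i j (suc i) l
          ≈⟨ +-cong (shifted-next i (λ s → δ₂ i j s l) (λ s s<i → δ₂-> j l s<i)) (-1*x≈-x _) ⟩
        (δ₂ i j (suc i) l + ι (suc i) * δ₂ i j i l) + - δ₂ i j (suc i) l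
          ≈⟨ trans (+-congʳ (+-comm _ _)) (trans (+-assoc _ _ _) (trans (+-congˡ (-‿inverseʳ _)) (+-identityʳ _))) ⟩
        ι (suc i) * δ₂ i j i l
          ≈⟨ *-congˡ (δ₂-suc i j l) ⟩
        ι (suc i) * δ₂ (suc i) j (suc i) l ∎ }

-- Constants of D_x and Δ_x lie in K(y^m).

module ConstantsInY {c ℓ} (F : Field c ℓ) (charZero : Over.CharZero F) (q : Field.Carrier F)
  (m : ℕ) (order : Over.MinimalOrder F q m) (T : TwistedDerivations.TwistedDerivation F q)
  (lowers : Lowering.LowersDegree F q T) where
  open Over F
  open Pairing F
  open Operators F
  open Adjoint
  open ConcreteOperators F
  open TwistedDerivations F
  open RootOfUnity F q m order
  open TwistedDerivation T
  open Wronskian F q T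
  open TwistedConstants F q T
  open Kronecker F
  open Lowering.LowersDegree lowers

  ∂-kernel : ∀ {p} → ∂ p ≋ 0P → ∀ i j → coeff p (suc i) j ≈ 0#
  ∂-kernel = triangular-kernel ∂-adjoint 1 (λ i → ι (suc i)) charZero below leading

  ∂-degree : ∀ {n p} → XDegree< (suc n) p → XDegree< n (∂ p)
  ∂-degree {n} {p} p< i j n≤i = trans (coeff-adjoint ∂-adjoint p i j) (ev-vanish _ p vanish)
    where
    vanish : ∀ k l → coeff p k l ≈ 0# ⊎ adjoint ∂-adjoint (δ₂ i j) k l ≈ 0#
    vanish k l with k ℕ.<? suc i
    ... | yes k<1+i = inj₂ (below i j k l k<1+i)
    ... | no  k≮1+i = inj₁ (p< k l (ℕ.≤-trans (s≤s n≤i) (ℕ.≮⇒≥ k≮1+i)))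

  module _ (n : ℕ) where
    private
      κ = kronecker n

    ∂-κ : ∀ b → ∂ (κ b) ≋ 0P
    ∂-κ b = ≈P⇒≋ {_} {0P} λ i j → trans (coeff-adjoint ∂-adjoint (κ b) i j)
      (trans (ev-adjoint (kronecker-adjoint n) _ b) (ev-0 (λ k l → below i j 0 _ (s≤s z≤n)) b))

    -- κ b is free of x, hence killed by ∂ and fixed by θ, and acts as a scalar.
    ∂-κ-* : ∀ b p → ∂ (κ b *P p) ≋ κ b *P ∂ p
    ∂-κ-* b p = begin
      ∂ (κ b *P p)                                ≈⟨ ∂-* (κ b) p ⟩
      (∂ (κ b) *P p) +P (θ (κ b) *P ∂ p)          ≈⟨ P.+-cong (P.*-congʳ {p} (∂-κ b)) (P.*-congʳ {∂ p} θκ) ⟩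
      κ b *P ∂ p                                  ∎
      where
      open SetoidReasoning P.setoid
      θκ : θ (κ b) ≋ κ b
      θκ = begin
        θ (κ b)                           ≈⟨ θ-step (κ b) ⟩
        κ b +P (step *P ∂ (κ b))          ≈⟨ P.+-congˡ {κ b} (annihilated {step} (∂-κ b)) ⟩
        κ b +P 0P                         ≈⟨ P.+-identityʳ (κ b) ⟩
        κ b                               ∎

    ∂ⁿ-κ-* : ∀ k b p → ∂ⁿ k (κ b *P p) ≋ κ b *P ∂ⁿ k p
    ∂ⁿ-κ-* zero    b p = ≋-refl
    ∂ⁿ-κ-* (suc k) b p = P.trans (cong ∂-adjoint (∂ⁿ-κ-* k b p)) (∂-κ-* b (∂ⁿ k p))

    ∂ⁿ-difference : ∀ k p r → ∂ⁿ k (p +P (-P r)) ≋ ∂ⁿ k p +P (-P ∂ⁿ k r)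
    ∂ⁿ-difference zero    p r = ≋-refl
    ∂ⁿ-difference (suc k) p r = P.trans (cong ∂-adjoint (∂ⁿ-difference k p r))
      (P.trans (+-homo ∂-adjoint (∂ⁿ k p) (-P ∂ⁿ k r)) (P.+-congˡ {∂ⁿ (suc k) p} (-‿homo ∂-adjoint (∂ⁿ k r))))

    ∂ⁿ-suc : ∀ k p → ∂ⁿ k (∂ p) ≡ ∂ⁿ (suc k) p
    ∂ⁿ-suc zero    p = ≡.refl
    ∂ⁿ-suc (suc k) p = ≡.cong ∂ (∂ⁿ-suc k p)

    -- By induction ∂ p = 0, so p is a polynomial in y and is fixed by x ↦ y^n.
    taylor : ∀ d p → XDegree< d p → (∀ k → k ≤ d → κ (∂ⁿ k p) ≋ 0P) → p ≋ 0P
    taylor zero    p p< _    = ≈P⇒≋ {p} {0P} λ i j → p< i j z≤n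
    taylor (suc d) p p< κ∂≋0 = P.trans (P.sym fixed) (κ∂≋0 0 z≤n)
      where
      ∂p≋0 : ∂ p ≋ 0P
      ∂p≋0 = taylor d (∂ p) (∂-degree {d} {p} p<) λ k k≤d →
        ≡.subst (λ r → κ r ≋ 0P) (≡.sym (∂ⁿ-suc k p)) (κ∂≋0 (suc k) (s≤s k≤d))
      fixed : κ p ≋ p
      fixed = by-ev λ φ → trans (ev-adjoint (kronecker-adjoint n) φ p) (ev-agree _ _ p agree)
        where
        agree : ∀ {φ : Weight} i j → coeff p i j ≈ 0# ⊎ φ 0 (i ℕ.* n ℕ.+ j) ≈ φ i j
        agree zero    j = inj₂ refl
        agree (suc i) j = inj₁ (∂-kernel ∂p≋0 i j)

  -- x^i y^j becomes y^(i n + j); the additional eigenvalue q^(i n) is 1 since m divides n.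
  κ-τy : ∀ n → m ∣ n → ∀ p → τyP q (kronecker n p) ≋ kronecker n (τyP q p)
  κ-τy n m∣n = commute (τy-adjoint q) (kronecker-adjoint n) λ φ i j → *-congʳ
    (trans (pow-+ q (i ℕ.* n) j) (trans (*-congʳ (pow-∣ (∣n⇒∣m*n i m∣n))) (*-identityˡ _)))

  κ-supported : ∀ n → m ∣ n → ∀ {p} → τyP q p ≋ p → Supported (Adm-ym m) (kronecker n p)
  κ-supported n m∣n {p} τp≋p zero    j ¬adm = coeff-τy-fixed
    (P.trans (κ-τy n m∣n p) (cong (kronecker-adjoint n) τp≋p)) 0 j (λ m∣j → ¬adm (≡.refl , m∣j))
  κ-supported n m∣n {p} τp≋p (suc i) j ¬adm = coeff-kronecker-suc n p i j

  -- A/V does not depend on x, so it equals its own value at x = y^n, taken after expansion by the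
  -- torsion t.
  constants-in-y : ∀ A V → NonZero V → τyP q A ≋ A → τyP q V ≋ V → wronskian A V ≋ 0P →
    InSubfield (Adm-ym m) (A , V)
  constants-in-y A V V≉0 τA≋A τV≋V W≋0 =
    (κ (t *P A) , κ (t *P V)) ,
    nonzeroP (kronecker-NonZero n b≤n (NonZero-* (torsion-NonZero d) V≉0)) ,
    κ-supported n (m∣m*n (suc (bound (t *P V)))) (P.trans (τy-* q t A) (P.*-cong τt≋t τA≋A)) ,
    κ-supported n (m∣m*n (suc (bound (t *P V)))) (P.trans (τy-* q t V) (P.*-cong τt≋t τV≋V)) ,
    ≋⇒≈P equation
    where
    open Torsion A V V≉0 W≋0
    open PSolver
    open SetoidReasoning P.setoid
    -- Exceeds the degrees in x of A and V, so that finitely many derivatives decide whether G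
    -- vanishes.
    d = bound A ℕ.+ bound V
    t = torsion d
    -- A multiple of m, for invariance, and at least `bound (t *P V)`, so that the denominator
    -- survives; the successor makes n nonzero.
    n = m ℕ.* suc (bound (t *P V))
    κ = kronecker n
    instance
      m≢0 : ℕ.NonZero m
      m≢0 = ℕ.>-nonZero (proj₁ order)
      n≢0 : ℕ.NonZero n
      n≢0 = ℕ.m*n≢0 m (suc (bound (t *P V)))
    b≤n : bound (t *P V) ≤ n
    b≤n = ℕ.≤-trans (ℕ.n≤1+n _) (ℕ.m≤n*m (suc (bound (t *P V))) m)
    τt≋t : τyP q t ≋ t
    τt≋t = torsion-fixed τV≋V d
    G : Poly
    G = κ t *P ((κ V *P A) +P (-P (κ A *P V)))
    G≋0 : G ≋ 0P
    -- Values of κ are scalars for ∂ and fixed by κ, so κ (∂ⁿ k G) = κ (t · Y k), which the torsion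
    -- makes zero.
    G≋0 = taylor n d G
      (xdegree-kronecker-* n t (xdegree-difference {d} {κ V *P A} {κ A *P V}
        (xdegree-kronecker-* {d} {A} n V (xdegree-bound A (ℕ.m≤m+n _ _)))
        (xdegree-kronecker-* {d} {V} n A (xdegree-bound V (ℕ.m≤n+m _ _)))))
      λ k k≤d → begin
        κ (∂ⁿ k G)
          ≈⟨ cong (kronecker-adjoint n) (P.trans (∂ⁿ-κ-* n k t _) (P.*-congˡ {κ t} (P.trans (∂ⁿ-difference n k (κ V *P A) (κ A *P V))
               (P.+-cong (∂ⁿ-κ-* n k V A) (P.-‿cong (∂ⁿ-κ-* n k A V)))))) ⟩
        κ (κ t *P ((κ V *P ∂ⁿ k A) +P (-P (κ A *P ∂ⁿ k V))))
          ≈⟨ P.trans (kronecker-* n (κ t) _) (P.*-cong (kronecker-kronecker n t) (P.trans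
               (+-homo (kronecker-adjoint n) (κ V *P ∂ⁿ k A) (-P (κ A *P ∂ⁿ k V)))
               (P.+-cong (P.trans (kronecker-* n (κ V) (∂ⁿ k A)) (P.*-congʳ {κ (∂ⁿ k A)} (kronecker-kronecker n V)))
                 (P.trans (-‿homo (kronecker-adjoint n) (κ A *P ∂ⁿ k V))
                   (P.-‿cong (P.trans (kronecker-* n (κ A) (∂ⁿ k V)) (P.*-congʳ {κ (∂ⁿ k V)} (kronecker-kronecker n A)))))))) ⟩
        κ t *P ((κ V *P κ (∂ⁿ k A)) +P (-P (κ A *P κ (∂ⁿ k V))))
          ≈⟨ P.*-congˡ {κ t} (P.+-cong (P.*-comm (κ V) (κ (∂ⁿ k A))) (P.-‿cong (P.*-comm (κ A) (κ (∂ⁿ k V))))) ⟩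
        κ t *P ((κ (∂ⁿ k A) *P κ V) +P (-P (κ (∂ⁿ k V) *P κ A)))
          ≈⟨ P.trans (kronecker-* n t (Y k)) (P.*-congˡ {κ t} (P.trans
               (+-homo (kronecker-adjoint n) (∂ⁿ k A *P V) (-P (∂ⁿ k V *P A)))
               (P.+-cong (kronecker-* n (∂ⁿ k A) V) (P.trans (-‿homo (kronecker-adjoint n) (∂ⁿ k V *P A))
                 (P.-‿cong (kronecker-* n (∂ⁿ k V) A)))))) ⟨
        κ (t *P Y k)
          ≈⟨ P.trans (cong (kronecker-adjoint n) (torsion-kills d k k≤d)) (0-homo (kronecker-adjoint n)) ⟩
        0P ∎
    equation : A *P κ (t *P V) ≋ κ (t *P A) *P V
    equation = diff≋0⇒≋ (begin
      (A *P κ (t *P V)) +P (-P (κ (t *P A) *P V))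
        ≈⟨ P.+-cong (P.*-congˡ {A} (kronecker-* n t V)) (P.-‿cong (P.*-congʳ {V} (kronecker-* n t A))) ⟩
      (A *P (κ t *P κ V)) +P (-P ((κ t *P κ A) *P V))
        ≈⟨ solve 5 (λ a v t a' v' → a :* (t :* v') :+ :- ((t :* a') :* v) := t :* (v' :* a :+ :- (a' :* v)))
             ≋-refl A V (κ t) (κ A) (κ V) ⟩
      G     ≈⟨ G≋0 ⟩
      0P    ∎)

-- Constants of Δ_{q,x} lie in K(x^m, y^m).

module ConstantsInPowers {c ℓ} (F : Field c ℓ) (q : Field.Carrier F) (q≉0 : ¬ Field._≈_ F q (Field.0# F))
  (m : ℕ) (order : Over.MinimalOrder F q m) where
  open Over F
  open Pairing F
  open Operators F
  open Adjoint
  open ConcreteOperators F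
  open TwistedDerivations F
  open RootOfUnity F q m order
  open TwistedDerivation (q-difference q q≉0)
  open TwistedConstants F q (q-difference q q≉0)

  -- Over the norm M of V, the numerator A · conjugates ought to be invariant under τ_{q,x}, but
  -- constancy of A/V shows this only after multiplication by M. Hence the denominator M².
  constants-in-powers : ∀ A V → NonZero V → τyP q A ≋ A → τyP q V ≋ V → wronskian A V ≋ 0P →
    InSubfield (Adm-xm-ym m) (A , V)
  constants-in-powers A V V≉0 τA≋A τV≋V W≋0 =
    (N , M *P M) ,
    nonzeroP (NonZero-* M≉0 M≉0) ,
    supported N τxN τyN ,
    supported (M *P M) (P.trans (τx-* q M M) (P.*-cong norm-fixed norm-fixed)) (P.trans (τy-* q M M) (P.*-cong τyM τyM)) ,
    ≋⇒≈P (solve 3 (λ a k v → a :* ((k :* v) :* (k :* v)) := ((a :* k) :* (k :* v)) :* v) ≋-refl A conjugates V)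
    where
    open PSolver
    open SetoidReasoning P.setoid
    τx-1 : τxP q 1P ≋ 1P
    τx-1 = by-ev λ φ → +-congʳ (*-congʳ (*-identityʳ _))
    τy-1 : τyP q 1P ≋ 1P
    τy-1 = by-ev λ φ → +-congʳ (*-congʳ (*-identityʳ _))
    open Norm (norm (τx-adjoint q) (τx-* q) τx-1 (τx-NonZero q≉0) V (iterate-τx V))
    M N : Poly
    M = conjugates *P V
    N = (A *P conjugates) *P M
    M≉0 : NonZero M
    M≉0 = NonZero-* (conjugates-NonZero V≉0) V≉0
    τyK : τyP q conjugates ≋ conjugates
    τyK = conjugates-fixed (τy-adjoint q) (τy-* q) τy-1 (τx-τy q) τV≋V
    τyM : τyP q M ≋ M
    τyM = P.trans (τy-* q conjugates V) (P.*-cong τyK τV≋V)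
    τyN : τyP q N ≋ N
    τyN = P.trans (τy-* q (A *P conjugates) M) (P.*-cong (P.trans (τy-* q A conjugates) (P.*-cong τA≋A τyK)) τyM)
    τxN : τxP q N ≋ N
    τxN = begin
      τxP q N
        ≈⟨ P.trans (τx-* q (A *P conjugates) M) (P.*-cong (τx-* q A conjugates) norm-fixed) ⟩
      (τxP q A *P τxP q conjugates) *P (conjugates *P V)
        ≈⟨ solve 4 (λ a' k' k v → (a' :* k') :* (k :* v) := (a' :* v) :* (k :* k')) ≋-refl (τxP q A) (τxP q conjugates) conjugates V ⟩
      (τxP q A *P V) *P (conjugates *P τxP q conjugates)
        ≈⟨ P.*-congʳ {conjugates *P τxP q conjugates} (θ-swap {A} {V} W≋0) ⟩
      (A *P τxP q V) *P (conjugates *P τxP q conjugates)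
        ≈⟨ solve 4 (λ a v' k k' → (a :* v') :* (k :* k') := (a :* k) :* (k' :* v')) ≋-refl A (τxP q V) conjugates (τxP q conjugates) ⟩
      (A *P conjugates) *P (τxP q conjugates *P τxP q V)
        ≈⟨ P.*-congˡ {A *P conjugates} (P.trans (P.sym (τx-* q conjugates V)) norm-fixed) ⟩
      N ∎
    supported : ∀ p → τxP q p ≋ p → τyP q p ≋ p → Supported (Adm-xm-ym m) p
    supported p τx τy i j ¬adm with m ∣? i
    ... | no  m∤i = coeff-τx-fixed τx i j m∤i
    ... | yes m∣i = coeff-τy-fixed τy i j (λ m∣j → ¬adm (m∣i , m∣j))

-- Return to the three given operators.

module Assembly {c ℓ} (F : Field c ℓ) (charZero : Over.CharZero F) (q : Field.Carrier F) (q≉0 : ¬ Field._≈_ F q (Field.0# F))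
  (m : ℕ) (order : Over.MinimalOrder F q m) where
  open Over F
  open Pairing F
  open Operators F
  open Adjoint
  open ConcreteOperators F
  open TwistedDerivations F
  open RootOfUnity F q m order
  open PSolver

  operator : XOp → TwistedDerivation q
  operator D  = derivation q
  operator Δ  = shift-difference q
  operator Δq = q-difference q q≉0

  module _ (op : XOp) where
    open TwistedDerivation (operator op) public

  private
    expand : ∀ n θn d θd → (θn *P d) +P (-P (n *P θd)) ≋ ((θn +P (-P n)) *P d) +P (-P (n *P (θd +P (-P d))))
    expand n θn d θd = solve 4 (λ n n' d d' → n' :* d :+ :- (n :* d') := (n' :+ :- n) :* d :+ :- (n :* (d' :+ :- d)))
      ≋-refl n θn d θd

  num-∂x : ∀ op n d → num (∂x op q (n , d)) ≋ wronskian op n d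
  num-∂x D  n d = ≋-refl
  num-∂x Δ  n d = expand n (σxP n) d (σxP d)
  num-∂x Δq n d = expand n (τxP q n) d (τxP q d)

  den-∂x : ∀ op n d → den (∂x op q (n , d)) ≡ θ op d *P d
  den-∂x D  n d = ≡.refl
  den-∂x Δ  n d = ≡.refl
  den-∂x Δq n d = ≡.refl

  extra : ∀ op A V → NonZero V → τyP q A ≋ A → τyP q V ≋ V → wronskian op A V ≋ 0P →
    ExtraCondition op m (A , V)
  extra D  = ConstantsInY.constants-in-y F charZero q m order (derivation q) (Lowering.derivation-lowers F q)
  extra Δ  = ConstantsInY.constants-in-y F charZero q m order (shift-difference q) (Lowering.shift-difference-lowers F q)
  extra Δq = ConstantsInPowers.constants-in-powers F q q≉0 m order

  solution : ∀ op f g → Valid f → Valid g → ∂x op q f ≈R Δqy q g →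
    ∃ λ (h : Rat) → ∃ λ (a : Rat) → ∃ λ (b : Rat) →
    Valid h × Valid a × Valid b ×
    InSubfield (Adm-x-ym m) a × InSubfield (Adm-x-ym m) b ×
    (∂x op q a ≈R 0R) ×
    (f ≈R (Δqy q h +R a)) × (g ≈R (∂x op q h +R b)) ×
    ExtraCondition op m a
  solution op (f₁ , f₂) (g₁ , g₂) f₂≉0 g₂≉0 hyp =
    -- Taking g - ∂h itself for b makes the equation for g a formal identity; the work lies in
    -- showing that b is in the subfield.
    (H , W) , (A , V) , ((g₁ , g₂) -R ∂h) ,
    nonzeroP W≉0 , nonzeroP V≉0 , nonzeroP (NonZero-* {g₂} {den ∂h} (nonzero g₂≉0) den-∂h≉0) ,
    ((A , V) , nonzeroP V≉0 , supported τA≋A , supported τV≋V , λ i j → refl) ,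
    -- The second representation of b, with invariant numerator and denominator.
    ((Y , W² *P (θ op W *P W)) ,
      nonzeroP (NonZero-* W²≉0 (NonZero-* (θ-NonZero op W≉0) W≉0)) ,
      supported τY≋Y ,
      supported (P.trans (τy-* q W² (θ op W *P W)) (P.*-cong τW²≋W² (P.trans (τy-* q (θ op W) W) (P.*-cong τθW τW≋W)))) ,
      ≋⇒≈P b-equation′) ,
    ≋⇒≈P (P.trans (P.*-comm (num (∂x op q (A , V))) 1P) (P.trans (P.*-identityˡ (num (∂x op q (A , V)))) (P.trans (num-∂x op A V) wronskian-AV))) ,
    ≋⇒≈P f-equation ,
    ≋⇒≈P (solve 4 (λ g d h e → g :* (e :* (d :* e)) := (h :* (d :* e) :+ (g :* e :+ :- (h :* d)) :* e) :* d)
      ≋-refl g₁ g₂ (num ∂h) (den ∂h)) ,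
    extra op A V V≉0 τA≋A τV≋V wronskian-AV
    where
    hypothesis : wronskian op f₁ f₂ *P (τyP q g₂ *P g₂) ≋
      ((τyP q g₁ *P g₂) +P (-P (g₁ *P τyP q g₂))) *P (θ op f₂ *P f₂)
    hypothesis = ≡.subst
      (λ e → wronskian op f₁ f₂ *P (τyP q g₂ *P g₂) ≋ ((τyP q g₁ *P g₂) +P (-P (g₁ *P τyP q g₂))) *P e)
      (den-∂x op f₁ f₂)
      (P.trans (P.*-congʳ {τyP q g₂ *P g₂} (P.sym (num-∂x op f₁ f₂)))
        (≈P⇒≋ {num (∂x op q (f₁ , f₂)) *P den (Δqy q (g₁ , g₂))} {num (Δqy q (g₁ , g₂)) *P den (∂x op q (f₁ , f₂))} hyp))
    open Construction.Solve F q q≉0 m order (operator op) f₁ f₂ g₁ g₂ (nonzero f₂≉0) (nonzero g₂≉0) hypothesis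
    ∂h : Rat
    ∂h = ∂x op q (H , W)
    den-∂h≉0 : NonZero (den ∂h)
    den-∂h≉0 = ≡.subst NonZero (≡.sym (den-∂x op H W)) (NonZero-* (θ-NonZero op W≉0) W≉0)
    supported : ∀ {p} → τyP q p ≋ p → Supported (Adm-x-ym m) p
    supported τp≋p i j = coeff-τy-fixed τp≋p i j
    b-equation′ : ((g₁ *P den ∂h) +P (-P (num ∂h *P g₂))) *P (W² *P (θ op W *P W)) ≋ Y *P (g₂ *P den ∂h)
    b-equation′ = ≡.subst
      (λ e → ((g₁ *P e) +P (-P (num ∂h *P g₂))) *P (W² *P (θ op W *P W)) ≋ Y *P (g₂ *P e))
      (≡.sym (den-∂x op H W)) (b-equation (num-∂x op H W))

theorem1 : ∀ {c ℓ} (F : Field c ℓ) → let open Over F in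
    AlgClosed → CharZero →
    (q : Carrier) → ¬ (q ≈ 0#) → (m : ℕ) → MinimalOrder q m →
    (op : XOp) → (f g : Rat) → Valid f → Valid g →
    ∂x op q f ≈R Δqy q g →
    ∃ λ (h : Rat) → ∃ λ (a : Rat) → ∃ λ (b : Rat) →
    Valid h × Valid a × Valid b ×
    InSubfield (Adm-x-ym m) a × InSubfield (Adm-x-ym m) b ×
    (∂x op q a ≈R 0R) ×
    (f ≈R (Δqy q h +R a)) × (g ≈R (∂x op q h +R b)) ×
    ExtraCondition op m a
theorem1 F _ charZero q q≉0 m order = Assembly.solution F charZero q q≉0 m order
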